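{- Let $q,t$ be natural numbers with $\gcd(t,q)=1$, and let $a$ be an integer with $\gcd(a,q)=1$ such that $t$ divides $a^2+1$. Put $b=q(a^2+1)/t$. Then $$S(a,b)=\frac{(q^2-1)a}{tq}-S(aq,t)+S(at^*,q),$$ where $t^*$ is any integer with $tt^*\equiv 1\pmod q$.
   Context: For $x\in\mathbb{R}$ let $((x))=x-\lfloor x\rfloor-1/2$ if $x\notin\mathbb{Z}$ and $((x))=0$ if $x\in\mathbb{Z}$. For $a\in\mathbb{Z}$, $b\in\mathbb{N}$ with $\gcd(a,b)=1$, the classical Dedekind sum is $s(a,b)=\sum_{j=1}^{b}((j/b))((aj/b))$, and the normalized Dedekind sum is $S(a,b)=12\,s(a,b)$. -}

module Defs where

open import Data.Bool.Base using (if_then_else_)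
open import Data.Nat.Base as ℕ using (ℕ; zero; suc)
open import Data.Integer.Base as ℤ using (ℤ; +_)
open import Data.Rational.Base using (ℚ; 0ℚ; ½; _+_; _-_; _*_; _/_; ↧ₙ_; floor)

-- The sawtooth function ((x)) on rationals:
-- ((x)) = x - ⌊x⌋ - 1/2 if x is not an integer, and 0 if x is an integer
-- (x ∈ ℚ is an integer iff its reduced denominator is 1).
saw : ℚ → ℚ
saw x = if (↧ₙ x ℕ.≡ᵇ 1) then 0ℚ else (x - (floor x / 1)) - ½

-- Classical Dedekind sum s(a,b) = Σ_{j=1}^{b} ((j/b)) ((a j / b)), for b ≥ 1.
-- (b = 0 is given the junk value 0; it never occurs in the theorem.)
dedekind : ℤ → ℕ → ℚ
dedekind a zero = 0ℚ
dedekind a (suc k) = go (suc k)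
  where
  go : ℕ → ℚ
  go zero = 0ℚ
  go (suc j) = saw (+ suc j / suc k) * saw ((a ℤ.* + suc j) / suc k) + go j

S : ℤ → ℕ → ℚ
S a b = (+ 12 / 1) * dedekind a b

{-# OPTIONS --safe #-}
module Submission where

-- Put a > 0 (the statement is odd in a).  Both Dedekind's reciprocity law, for
-- the pair (a, b), and Rademacher's three-term law, for the pairwise coprime
-- triple (a, t, q), are instances of
--   s(b,c;a) + s(c,a;b) + s(a,b;c) = -1/4 + (a/bc + b/ca + c/ab) / 12,
-- where s(b,c;a) = Σ_{j mod a} ((bj/a)) ((cj/a)).  Since t b = q (a² + 1), the
-- first summand s(b,1;a) of the former equals s(t,q;a), and subtracting the two
-- laws gives the theorem; s(q,a;t) = -s(1,aq;t) because a² ≡ -1 mod t.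
-- The three-term law holds because ((ax)) ((bx)) ((cx)) has period 1: the sum of
-- its increments over the points n/(abc), 0 ≤ n < abc, is zero, the jumps at the
-- multiples of 1/a, 1/b, 1/c contribute the three Dedekind sums, and the smooth
-- increments are evaluated by the Chinese remainder theorem.
-- All sums are taken in ℤ, with 2m ((n/m)) in place of ((n/m)).

open import Defs
open import Algebra.Properties.AbelianGroup using (∙-cancelˡ)
open import Data.Empty using (⊥-elim)
open import Data.Integer.Base as ℤ using (ℤ; +_; -[1+_]; 0ℤ; 1ℤ; _+_; _-_; _*_; -_; ∣_∣; _%ℕ_; _/ℕ_)
open import Data.Integer.DivMod using (n%ℕd<d; a≡a%ℕn+[a/ℕn]*n; div-pos-is-/ℕ)
open import Data.Integer.Divisibility using (_∣_)
import Data.Integer.Divisibility.Signed as Signed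
open import Data.Integer.GCD using (gcd)
import Data.Integer.Properties as ℤ
open import Data.Integer.Tactic.RingSolver using (solve-∀)
open import Data.Nat.Base as ℕ using (ℕ; zero; suc; NonZero; s≤s)
open import Data.Nat.Coprimality using (gcd≡1⇒coprime; coprime-Bézout)
import Data.Nat.DivMod as ℕ
import Data.Nat.Divisibility as ℕ
open import Data.Nat.GCD as ℕ using (module Bézout)
import Data.Nat.Properties as ℕ
open import Data.Nat.Properties using (m*n≢0)
open import Data.Product.Base using (∃; _,_)
open import Data.Rational.Base as ℚ using (ℚ; mkℚ; 0ℚ; ½; _/_; ↥_; ↧ₙ_; floor; toℚᵘ)
import Data.Rational.Properties as ℚ
open import Data.Rational.Solver using (module +-*-Solver)
open import Data.Rational.Unnormalised.Base as ℚᵘ using (mkℚᵘ; *≡*)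
import Data.Rational.Unnormalised.Properties as ℚᵘ
open import Relation.Binary.PropositionalEquality using (_≡_; refl; sym; trans; cong; cong₂; subst; subst₂; module ≡-Reasoning)
open import Relation.Nullary using (¬_)
open import Relation.Nullary.Decidable.Core using (recompute)
open ≡-Reasoning
open +-*-Solver using (solve; _:+_; _:*_; _:-_; con; _:=_)

-- Finite sums and periodic functions

sum : ℕ → (ℤ → ℤ) → ℤ
sum zero    f = 0ℤ
sum (suc n) f = sum n f + f (+ n)

sum-cong-< : ∀ n {f g : ℤ → ℤ} → (∀ j → j ℕ.< n → f (+ j) ≡ g (+ j)) → sum n f ≡ sum n g
sum-cong-< zero    eq = refl
sum-cong-< (suc n) eq =
  cong₂ _+_ (sum-cong-< n λ j j<n → eq j (ℕ.m<n⇒m<1+n j<n)) (eq n (ℕ.n<1+n n))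

sum-cong : ∀ n {f g : ℤ → ℤ} → (∀ x → f x ≡ g x) → sum n f ≡ sum n g
sum-cong n eq = sum-cong-< n λ j _ → eq (+ j)

sum-+ : ∀ n f g → sum n (λ x → f x + g x) ≡ sum n f + sum n g
sum-+ zero    f g = refl
sum-+ (suc n) f g = trans (cong (_+ (f (+ n) + g (+ n))) (sum-+ n f g))
  (ring (sum n f) (sum n g) (f (+ n)) (g (+ n)))
  where
  ring : ∀ x y u v → (x + y) + (u + v) ≡ (x + u) + (y + v)
  ring = solve-∀

sum-*ˡ : ∀ n c f → sum n (λ x → c * f x) ≡ c * sum n f
sum-*ˡ zero    c f = sym (ℤ.*-zeroʳ c)
sum-*ˡ (suc n) c f = trans (cong (_+ c * f (+ n)) (sum-*ˡ n c f)) (sym (ℤ.*-distribˡ-+ c _ _))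

sum-*ʳ : ∀ n c f → sum n (λ x → f x * c) ≡ sum n f * c
sum-*ʳ n c f = begin
  sum n (λ x → f x * c) ≡⟨ sum-cong n (λ x → ℤ.*-comm (f x) c) ⟩
  sum n (λ x → c * f x) ≡⟨ sum-*ˡ n c f ⟩
  c * sum n f           ≡⟨ ℤ.*-comm c _ ⟩
  sum n f * c           ∎

sum-neg : ∀ n f → sum n (λ x → - f x) ≡ - sum n f
sum-neg zero    f = refl
sum-neg (suc n) f = trans (cong (_- f (+ n)) (sum-neg n f)) (sym (ℤ.neg-distrib-+ (sum n f) (f (+ n))))

sum-const : ∀ n c → sum n (λ _ → c) ≡ + n * c
sum-const zero    c = refl
sum-const (suc n) c = trans (cong (_+ c) (sum-const n c)) (ring (+ n) c)
  where
  ring : ∀ n c → n * c + c ≡ (1ℤ + n) * c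
  ring = solve-∀

sum-zero : ∀ n {f : ℤ → ℤ} → (∀ x → f x ≡ 0ℤ) → sum n f ≡ 0ℤ
sum-zero n eq = trans (sum-cong n eq) (trans (sum-const n 0ℤ) (ℤ.*-zeroʳ (+ n)))

sum-swap : ∀ m n (f : ℤ → ℤ → ℤ) →
  sum m (λ x → sum n (λ y → f x y)) ≡ sum n (λ y → sum m (λ x → f x y))
sum-swap zero    n f = sym (sum-zero n λ _ → refl)
sum-swap (suc m) n f = trans (cong (_+ sum n (f (+ m))) (sum-swap m n f))
  (sym (sum-+ n (λ y → sum m (λ x → f x y)) (f (+ m))))

sum-suc : ∀ n f → sum (suc n) f ≡ f 0ℤ + sum n (λ x → f (x + 1ℤ))
sum-suc zero    f = ℤ.+-comm 0ℤ (f 0ℤ)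
sum-suc (suc n) f = begin
  sum (suc n) f + f (+ suc n)                                  ≡⟨ cong₂ _+_ (sum-suc n f) (cong f (ℤ.+-comm 1ℤ (+ n))) ⟩
  (f 0ℤ + sum n (λ x → f (x + 1ℤ))) + f (+ n + 1ℤ)             ≡⟨ ℤ.+-assoc (f 0ℤ) _ _ ⟩
  f 0ℤ + sum (suc n) (λ x → f (x + 1ℤ))                        ∎

sum-telescope : ∀ n (f : ℤ → ℤ) → sum n (λ x → f x - f (x - 1ℤ)) ≡ f (+ n - 1ℤ) - f (0ℤ - 1ℤ)
sum-telescope zero    f = sym (ℤ.+-inverseʳ (f (0ℤ - 1ℤ)))
sum-telescope (suc n) f = begin
  sum n (λ x → f x - f (x - 1ℤ)) + (f (+ n) - f (+ n - 1ℤ)) ≡⟨ cong (_+ (f (+ n) - f (+ n - 1ℤ))) (sum-telescope n f) ⟩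
  (f (+ n - 1ℤ) - f (0ℤ - 1ℤ)) + (f (+ n) - f (+ n - 1ℤ))   ≡⟨ ring (f (+ n - 1ℤ)) (f (0ℤ - 1ℤ)) (f (+ n)) ⟩
  f (+ n) - f (0ℤ - 1ℤ)                                     ≡⟨ cong (λ x → f x - f (0ℤ - 1ℤ)) (pred (+ n)) ⟩
  f (+ suc n - 1ℤ) - f (0ℤ - 1ℤ)                            ∎
  where
  ring : ∀ x y z → (x - y) + (z - x) ≡ z - y
  ring = solve-∀
  pred : ∀ x → x ≡ (1ℤ + x) - 1ℤ
  pred = solve-∀

sum-append : ∀ m n f → sum (m ℕ.+ n) f ≡ sum m f + sum n (λ x → f (x + + m))
sum-append m zero    f = trans (cong (λ k → sum k f) (ℕ.+-identityʳ m)) (sym (ℤ.+-identityʳ _))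
sum-append m (suc n) f = begin
  sum (m ℕ.+ suc n) f                                                ≡⟨ cong (λ k → sum k f) (ℕ.+-suc m n) ⟩
  sum (m ℕ.+ n) f + f (+ (m ℕ.+ n))                                  ≡⟨ cong₂ _+_ (sum-append m n f) (cong (λ k → f (+ k)) (ℕ.+-comm m n)) ⟩
  (sum m f + sum n (λ x → f (x + + m))) + f (+ n + + m)              ≡⟨ ℤ.+-assoc (sum m f) _ _ ⟩
  sum m f + sum (suc n) (λ x → f (x + + m))                          ∎

sum-blocks : ∀ d m f → sum (d ℕ.* m) f ≡ sum d (λ j → sum m (λ i → f (i + + m * j)))
sum-blocks zero    m f = refl
sum-blocks (suc d) m f = begin
  sum (m ℕ.+ d ℕ.* m) f                                ≡⟨ cong (λ k → sum k f) (ℕ.+-comm m (d ℕ.* m)) ⟩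
  sum (d ℕ.* m ℕ.+ m) f                                ≡⟨ sum-append (d ℕ.* m) m f ⟩
  sum (d ℕ.* m) f + sum m (λ i → f (i + + (d ℕ.* m)))  ≡⟨ cong₂ _+_ (sum-blocks d m f) (sum-cong m λ i → cong (λ k → f (i + k)) dm) ⟩
  sum (suc d) (λ j → sum m (λ i → f (i + + m * j)))    ∎
  where
  dm : + (d ℕ.* m) ≡ + m * + d
  dm = trans (ℤ.pos-* d m) (ℤ.*-comm (+ d) (+ m))

double-sum-id : ∀ n → + 2 * sum n (λ x → x) ≡ + n * (+ n - 1ℤ)
double-sum-id zero    = refl
double-sum-id (suc n) = begin
  + 2 * (sum n (λ x → x) + + n)     ≡⟨ ℤ.*-distribˡ-+ (+ 2) (sum n (λ x → x)) (+ n) ⟩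
  + 2 * sum n (λ x → x) + + 2 * + n ≡⟨ cong (_+ + 2 * + n) (double-sum-id n) ⟩
  + n * (+ n - 1ℤ) + + 2 * + n      ≡⟨ ring (+ n) ⟩
  + suc n * (+ suc n - 1ℤ)          ∎
  where
  ring : ∀ n → n * (n - 1ℤ) + + 2 * n ≡ (1ℤ + n) * ((1ℤ + n) - 1ℤ)
  ring = solve-∀

sum-affine : ∀ n u v → sum n (λ x → + 2 * (u * x) + v) ≡ u * (+ n * (+ n - 1ℤ)) + + n * v
sum-affine n u v = begin
  sum n (λ x → + 2 * (u * x) + v)                   ≡⟨ sum-+ n (λ x → + 2 * (u * x)) (λ _ → v) ⟩
  sum n (λ x → + 2 * (u * x)) + sum n (λ _ → v)     ≡⟨ cong₂ _+_ (trans (sum-cong n λ x → ring u x) (sum-*ˡ n (u * + 2) (λ x → x))) (sum-const n v) ⟩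
  u * + 2 * sum n (λ x → x) + + n * v               ≡⟨ cong (_+ + n * v) (ℤ.*-assoc u (+ 2) _) ⟩
  u * (+ 2 * sum n (λ x → x)) + + n * v             ≡⟨ cong (λ s → u * s + + n * v) (double-sum-id n) ⟩
  u * (+ n * (+ n - 1ℤ)) + + n * v                  ∎
  where
  ring : ∀ u x → + 2 * (u * x) ≡ u * + 2 * x
  ring = solve-∀

-- Congruences, units and sums over a full period

infix 4 _≡_mod_
-- The quotient is kept as data: matching the equation with `refl` reduces most rules for
-- congruences to ring identities, and a quotient can itself serve as an inverse, as in `unit-sym`.
record _≡_mod_ (x y : ℤ) (m : ℕ) : Set where
  constructor _,_
  field
    quotient : ℤ
    equation : x ≡ y + quotient * + m

mod-neg : ∀ {x y m} → x ≡ y mod m → - x ≡ - y mod m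
mod-neg {y = y} {m} (k , refl) = - k , ring y k (+ m)
  where
  ring : ∀ y k m → - (y + k * m) ≡ - y + - k * m
  ring = solve-∀

mod-+ʳ : ∀ {x y m} c → x ≡ y mod m → x + c ≡ y + c mod m
mod-+ʳ {y = y} {m} c (k , refl) = k , ring y k (+ m) c
  where
  ring : ∀ y k m c → (y + k * m) + c ≡ y + c + k * m
  ring = solve-∀

mod-+ˡ : ∀ {x y m} c → x ≡ y mod m → c + x ≡ c + y mod m
mod-+ˡ {y = y} {m} c (k , refl) = k , sym (ℤ.+-assoc c y (k * + m))

mod-*ˡ : ∀ {x y m} c → x ≡ y mod m → c * x ≡ c * y mod m
mod-*ˡ {y = y} {m} c (k , refl) = c * k , ring y k (+ m) c
  where
  ring : ∀ y k m c → c * (y + k * m) ≡ c * y + c * k * m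
  ring = solve-∀

mod-*ʳ : ∀ {x y m} c → x ≡ y mod m → x * c ≡ y * c mod m
mod-*ʳ {y = y} {m} c (k , refl) = k * c , ring y k (+ m) c
  where
  ring : ∀ y k m c → (y + k * m) * c ≡ y * c + k * c * m
  ring = solve-∀

mod-scale : ∀ {x y m} d → x ≡ y mod m → + d * x ≡ + d * y mod (d ℕ.* m)
mod-scale {y = y} {m} d (k , refl) = k , (begin
  + d * (y + k * + m)         ≡⟨ ring (+ d) y k (+ m) ⟩
  + d * y + k * (+ d * + m)   ≡⟨ cong (λ z → + d * y + k * z) (sym (ℤ.pos-* d m)) ⟩
  + d * y + k * + (d ℕ.* m)   ∎)
  where
  ring : ∀ d y k m → d * (y + k * m) ≡ d * y + k * (d * m)
  ring = solve-∀

Periodic : ℕ → (ℤ → ℤ) → Set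
Periodic m f = ∀ {x y} → x ≡ y mod m → f x ≡ f y

UnitMod : ℕ → ℤ → Set
UnitMod m c = ∃ λ c′ → c * c′ ≡ 1ℤ mod m

-- Moving the window of summation by one drops `g (0ℤ + c)` and takes in `g (+ n + c)`, and these
-- agree by hypothesis.
sum-shift-suc : ∀ n (g : ℤ → ℤ) c → g (+ n + c) ≡ g (0ℤ + c) →
  sum n (λ x → g (x + (c + 1ℤ))) ≡ sum n (λ x → g (x + c))
sum-shift-suc n g c eq = ∙-cancelˡ ℤ.+-0-abelianGroup (g (0ℤ + c)) _ _ (begin
  g (0ℤ + c) + sum n (λ x → g (x + (c + 1ℤ)))  ≡⟨ cong (λ z → g (0ℤ + c) + z) (sum-cong n λ x → cong g (ring x c)) ⟩
  g (0ℤ + c) + sum n (λ x → g ((x + 1ℤ) + c))  ≡⟨ sum-suc n (λ x → g (x + c)) ⟨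
  sum n (λ x → g (x + c)) + g (+ n + c)        ≡⟨ cong (λ z → sum n (λ x → g (x + c)) + z) eq ⟩
  sum n (λ x → g (x + c)) + g (0ℤ + c)         ≡⟨ ℤ.+-comm _ (g (0ℤ + c)) ⟩
  g (0ℤ + c) + sum n (λ x → g (x + c))         ∎)
  where
  ring : ∀ x c → x + (c + 1ℤ) ≡ (x + 1ℤ) + c
  ring = solve-∀

constant : ∀ (f : ℤ → ℤ) → (∀ x → f (x + 1ℤ) ≡ f x) → ∀ x → f x ≡ f 0ℤ
constant f step (+ zero)      = refl
constant f step (+ suc n)     = begin
  f (+ suc n)  ≡⟨ cong f (ℤ.+-comm 1ℤ (+ n)) ⟩
  f (+ n + 1ℤ) ≡⟨ step (+ n) ⟩
  f (+ n)      ≡⟨ constant f step (+ n) ⟩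
  f 0ℤ         ∎
constant f step -[1+ zero ]   = sym (step -[1+ 0 ])
constant f step -[1+ suc n ]  = trans (sym (step -[1+ suc n ])) (constant f step -[1+ n ])

sum-shift : ∀ m g → Periodic m g → ∀ c → sum m (λ x → g (x + c)) ≡ sum m g
sum-shift m g per c = begin
  sum m (λ x → g (x + c))   ≡⟨ constant (λ c → sum m (λ x → g (x + c))) (λ c → sum-shift-suc m g c (per (wrap c))) c ⟩
  sum m (λ x → g (x + 0ℤ))  ≡⟨ sum-cong m (λ x → cong g (ℤ.+-identityʳ x)) ⟩
  sum m g                   ∎
  where
  ring : ∀ m c → m + c ≡ 0ℤ + c + 1ℤ * m
  ring = solve-∀
  wrap : ∀ c → + m + c ≡ 0ℤ + c mod m
  wrap c = 1ℤ , ring (+ m) c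

-- T i = Σ_j g (i + c j) has the periods c and m, hence is constant, and its
-- mean over i is Σ g.
sum-unit : ∀ m .{{_ : NonZero m}} g → Periodic m g → ∀ c → UnitMod m c →
  ∀ i → sum m (λ j → g (i + c * j)) ≡ sum m g
sum-unit m g per c (c′ , (k , cc′)) i = trans (T-const i) (ℤ.*-cancelˡ-≡ (+ m) (T 0ℤ) (sum m g) mean)
  where
  T : ℤ → ℤ
  T i = sum m (λ j → g (i + c * j))

  T-per-m : Periodic m T
  T-per-m x≡y = sum-cong m λ j → per (mod-+ʳ (c * j) x≡y)

  T-per-c : ∀ i → T (i + c) ≡ T i
  T-per-c i = begin
    sum m (λ j → g ((i + c) + c * j))           ≡⟨ sum-cong m (λ j → cong g (ring i c j)) ⟩
    sum m (λ j → g (i + c * (j + 1ℤ)))          ≡⟨ sum-shift m (λ j → g (i + c * j)) (λ x≡y → per (mod-+ˡ i (mod-*ˡ c x≡y))) 1ℤ ⟩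
    sum m (λ j → g (i + c * j))                 ∎
    where
    ring : ∀ i c j → (i + c) + c * j ≡ i + c * (j + 1ℤ)
    ring = solve-∀

  T-per-cx : ∀ i x → T (i + c * x) ≡ T i
  T-per-cx i x = trans (constant (λ x → T (i + c * x)) (λ x → trans (cong T (ring i c x)) (T-per-c (i + c * x))) x) (cong T (ring₀ i c))
    where
    ring : ∀ i c x → i + c * (x + 1ℤ) ≡ (i + c * x) + c
    ring = solve-∀
    ring₀ : ∀ i c → i + c * 0ℤ ≡ i
    ring₀ = solve-∀

  -- Since c c′ ≡ 1 modulo m, a step of length 1 has the same effect as c′ steps of length c.
  T-const : ∀ i → T i ≡ T 0ℤ
  T-const = constant T λ i → begin
    T (i + 1ℤ)      ≡⟨ T-per-m {y = i + 1ℤ} (k , trans (cong (λ z → i + z) cc′) (sym (ℤ.+-assoc i 1ℤ (k * + m)))) ⟨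
    T (i + c * c′)  ≡⟨ T-per-cx i c′ ⟩
    T i             ∎

  mean : + m * T 0ℤ ≡ + m * sum m g
  mean = begin
    + m * T 0ℤ                                   ≡⟨ sum-const m (T 0ℤ) ⟨
    sum m (λ _ → T 0ℤ)                           ≡⟨ sum-cong m (λ i → sym (T-const i)) ⟩
    sum m T                                      ≡⟨ sum-swap m m (λ i j → g (i + c * j)) ⟩
    sum m (λ j → sum m (λ i → g (i + c * j)))    ≡⟨ sum-cong m (λ j → sum-shift m g per (c * j)) ⟩
    sum m (λ _ → sum m g)                        ≡⟨ sum-const m (sum m g) ⟩
    + m * sum m g                                ∎

sum-dilate : ∀ m .{{_ : NonZero m}} g → Periodic m g → ∀ c → UnitMod m c →
  sum m (λ j → g (c * j)) ≡ sum m g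
sum-dilate m g per c unit =
  trans (sum-cong m λ j → cong g (sym (ℤ.+-identityˡ (c * j)))) (sum-unit m g per c unit 0ℤ)

-- Write k = i + m j. The factor f sees only i; for fixed i, the argument i + m j of g runs through
-- all residues modulo n, because m is a unit there.
sum-crt : ∀ m n .{{_ : NonZero n}} f g → Periodic m f → Periodic n g → UnitMod n (+ m) →
  sum (n ℕ.* m) (λ k → f k * g k) ≡ sum m f * sum n g
sum-crt m n f g perf perg unit = begin
  sum (n ℕ.* m) (λ k → f k * g k)                                       ≡⟨ sum-blocks n m (λ k → f k * g k) ⟩
  sum n (λ j → sum m (λ i → f (i + + m * j) * g (i + + m * j)))         ≡⟨ sum-swap n m (λ j i → f (i + + m * j) * g (i + + m * j)) ⟩
  sum m (λ i → sum n (λ j → f (i + + m * j) * g (i + + m * j)))         ≡⟨ sum-cong m inner ⟩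
  sum m (λ i → f i * sum n g)                                           ≡⟨ sum-*ʳ m (sum n g) f ⟩
  sum m f * sum n g                                                     ∎
  where
  inner : ∀ i → sum n (λ j → f (i + + m * j) * g (i + + m * j)) ≡ f i * sum n g
  inner i = begin
    sum n (λ j → f (i + + m * j) * g (i + + m * j))   ≡⟨ sum-cong n (λ j → cong (_* g (i + + m * j)) (perf (j , cong (λ z → i + z) (ℤ.*-comm (+ m) j)))) ⟩
    sum n (λ j → f i * g (i + + m * j))               ≡⟨ sum-*ˡ n (f i) (λ j → g (i + + m * j)) ⟩
    f i * sum n (λ j → g (i + + m * j))               ≡⟨ cong (f i *_) (sum-unit n g perg (+ m) unit i) ⟩
    f i * sum n g                                     ∎

-- Residues and the integral sawtooth

mod-sym : ∀ {x y m} → x ≡ y mod m → y ≡ x mod m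
mod-sym {y = y} {m} (k , eq) = - k , trans (ring y k (+ m)) (cong (_+ - k * + m) (sym eq))
  where
  ring : ∀ y k m → y ≡ (y + k * m) + - k * m
  ring = solve-∀

mod-trans : ∀ {x y z m} → x ≡ y mod m → y ≡ z mod m → x ≡ z mod m
mod-trans {z = z} {m} (k , refl) (l , refl) = l + k , ring z k l (+ m)
  where
  ring : ∀ z k l m → (z + l * m) + k * m ≡ z + (l + k) * m
  ring = solve-∀

-- The value at modulus 0 is a convention that makes `rem`, and with it `δ` and `Q`, total in the
-- modulus without an instance argument.
rem : ℕ → ℤ → ℕ
rem zero    n = 0
rem (suc k) n = n %ℕ suc k

rem-< : ∀ m .{{_ : NonZero m}} n → rem m n ℕ.< m
rem-< (suc k) n = n%ℕd<d n (suc k)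

rem-mod : ∀ m .{{_ : NonZero m}} n → n ≡ + rem m n mod m
rem-mod (suc k) n = (n /ℕ suc k) , a≡a%ℕn+[a/ℕn]*n n (suc k)

exceeds-modulus : ∀ {m r s} k → + r ≡ + s + + suc k * + m → m ℕ.≤ r
exceeds-modulus {m} {r} {s} k eq = subst (m ℕ.≤_)
  (sym (ℤ.+-injective (trans eq (cong (λ z → + s + z) (sym (ℤ.pos-* (suc k) m))))))
  (ℕ.≤-trans (ℕ.m≤m+n m _) (ℕ.m≤n+m _ s))

-- The sign of the quotient decides: a positive one forces m ≤ r, a negative one m ≤ s.
small-residues-unique : ∀ {m r s} → r ℕ.< m → s ℕ.< m → + r ≡ + s mod m → r ≡ s
small-residues-unique {s = s} r<m s<m (+ zero , eq)   = ℤ.+-injective (trans eq (ℤ.+-identityʳ (+ s)))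
small-residues-unique r<m s<m (+ suc k , eq)          = ⊥-elim (ℕ.<⇒≱ r<m (exceeds-modulus k eq))
small-residues-unique r<m s<m r≡s@(-[1+ k ] , _)      = ⊥-elim (ℕ.<⇒≱ s<m (exceeds-modulus k (_≡_mod_.equation (mod-sym r≡s))))

rem-unique : ∀ {m n r} .{{_ : NonZero m}} → r ℕ.< m → n ≡ + r mod m → rem m n ≡ r
rem-unique {m} {n} r<m n≡r =
  small-residues-unique (rem-< m n) r<m (mod-trans (mod-sym (rem-mod m n)) n≡r)

rem-cong : ∀ m {x y} → x ≡ y mod m → rem m x ≡ rem m y
rem-cong zero    _   = refl
rem-cong (suc k) {x} {y} x≡y = rem-unique (rem-< (suc k) y) (mod-trans x≡y (rem-mod (suc k) y))

rem-small : ∀ {m r} → r ℕ.< m → rem m (+ r) ≡ r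
rem-small {suc k} {r} r<m = rem-unique r<m (0ℤ , sym (ℤ.+-identityʳ (+ r)))

rem-scale : ∀ d m .{{_ : NonZero d}} .{{_ : NonZero m}} n → rem (d ℕ.* m) (+ d * n) ≡ d ℕ.* rem m n
rem-scale d m n = rem-unique {{ℕ.m*n≢0 d m}} (ℕ.*-monoʳ-< d (rem-< m n))
  (subst (λ z → + d * n ≡ z mod (d ℕ.* m)) (sym (ℤ.pos-* d (rem m n))) (mod-scale d (rem-mod m n)))

isZero : ℕ → ℤ
isZero zero    = 1ℤ
isZero (suc _) = 0ℤ

isZero-scale : ∀ d .{{_ : NonZero d}} r → isZero (d ℕ.* r) ≡ isZero r
isZero-scale (suc d) zero    = cong isZero (ℕ.*-zeroʳ d)
isZero-scale (suc d) (suc r) = refl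

δ : ℕ → ℤ → ℤ
δ m n = isZero (rem m n)

δ-periodic : ∀ m → Periodic m (δ m)
δ-periodic m x≡y = cong isZero (rem-cong m x≡y)

δ-scale : ∀ d m .{{_ : NonZero d}} .{{_ : NonZero m}} n → δ (d ℕ.* m) (+ d * n) ≡ δ m n
δ-scale d m n = trans (cong isZero (rem-scale d m n)) (isZero-scale d (rem m n))

sum-δ : ∀ m .{{_ : NonZero m}} (h : ℤ → ℤ) → sum m (λ i → δ m i * h i) ≡ h 0ℤ
sum-δ (suc p) h = begin
  sum (suc p) (λ i → δ (suc p) i * h i)                          ≡⟨ sum-suc p (λ i → δ (suc p) i * h i) ⟩
  1ℤ * h 0ℤ + sum p (λ x → δ (suc p) (x + 1ℤ) * h (x + 1ℤ))       ≡⟨ cong (λ z → 1ℤ * h 0ℤ + z) (sum-cong-< p {g = λ _ → 0ℤ} λ j j<p → cong (λ r → isZero r * h (+ j + 1ℤ)) (vanish j j<p)) ⟩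
  1ℤ * h 0ℤ + sum p (λ x → 0ℤ)                                    ≡⟨ cong₂ _+_ (ℤ.*-identityˡ (h 0ℤ)) (sum-zero p λ _ → refl) ⟩
  h 0ℤ + 0ℤ                                                       ≡⟨ ℤ.+-identityʳ (h 0ℤ) ⟩
  h 0ℤ                                                            ∎
  where
  vanish : ∀ j → j ℕ.< p → rem (suc p) (+ j + 1ℤ) ≡ suc j
  vanish j j<p = trans (cong (λ k → rem (suc p) (+ k)) (ℕ.+-comm j 1)) (rem-small (s≤s j<p))

-- Cut the range into d blocks of length m; in each block only the first point is a multiple of m.
sum-δ-multiples : ∀ d m .{{_ : NonZero m}} (h : ℤ → ℤ) →
  sum (d ℕ.* m) (λ n → δ m n * h n) ≡ sum d (λ j → h (+ m * j))
sum-δ-multiples d m h = trans (sum-blocks d m (λ n → δ m n * h n)) (sum-cong d λ j → begin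
  sum m (λ i → δ m (i + + m * j) * h (i + + m * j))   ≡⟨ sum-cong m (λ i → cong (_* h (i + + m * j)) (δ-periodic m (j , cong (λ z → i + z) (ℤ.*-comm (+ m) j)))) ⟩
  sum m (λ i → δ m i * h (i + + m * j))               ≡⟨ sum-δ m (λ i → h (i + + m * j)) ⟩
  h (0ℤ + + m * j)                                    ≡⟨ cong h (ℤ.+-identityˡ (+ m * j)) ⟩
  h (+ m * j)                                         ∎)

-- Q m n = 2m ((n/m))
Q : ℕ → ℤ → ℤ
Q m n = + 2 * + rem m n - + m + + m * δ m n

Q-periodic : ∀ m → Periodic m (Q m)
Q-periodic m x≡y = cong (λ r → + 2 * + r - + m + + m * isZero r) (rem-cong m x≡y)

Q-rem-zero : ∀ m n → rem m n ≡ 0 → Q m n ≡ 0ℤ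
Q-rem-zero m n eq = trans (cong (λ r → + 2 * + r - + m + + m * isZero r) eq) (ring (+ m))
  where
  ring : ∀ m → + 2 * 0ℤ - m + m * 1ℤ ≡ 0ℤ
  ring = solve-∀

Q-rem-suc : ∀ m n {r} → rem m n ≡ suc r → Q m n ≡ + 2 * + suc r - + m
Q-rem-suc m n {r} eq = trans (cong (λ r → + 2 * + r - + m + + m * isZero r) eq) (ring (+ 2 * + suc r) (+ m))
  where
  ring : ∀ x m → x - m + m * 0ℤ ≡ x - m
  ring = solve-∀

Q-zero : ∀ m → Q m 0ℤ ≡ 0ℤ
Q-zero zero    = refl
Q-zero (suc k) = Q-rem-zero (suc k) 0ℤ refl

Q-small : ∀ {m r} → suc r ℕ.< m → Q m (+ suc r) ≡ + 2 * + suc r - + m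
Q-small {m} {r} r<m = Q-rem-suc m (+ suc r) (rem-small r<m)

-- The sawtooth itself takes the same value at dn/(dm) and n/m; the factor d comes from the
-- normalisation 2m of `Q`.
Q-scale : ∀ d m .{{_ : NonZero d}} .{{_ : NonZero m}} n → Q (d ℕ.* m) (+ d * n) ≡ + d * Q m n
Q-scale d m n = begin
  + 2 * + rem (d ℕ.* m) (+ d * n) - + (d ℕ.* m) + + (d ℕ.* m) * δ (d ℕ.* m) (+ d * n)
    ≡⟨ cong₂ (λ x y → + 2 * x - + (d ℕ.* m) + + (d ℕ.* m) * y) (trans (cong +_ (rem-scale d m n)) (ℤ.pos-* d (rem m n))) (δ-scale d m n) ⟩
  + 2 * (+ d * + rem m n) - + (d ℕ.* m) + + (d ℕ.* m) * δ m n
    ≡⟨ cong (λ x → + 2 * (+ d * + rem m n) - x + x * δ m n) (ℤ.pos-* d m) ⟩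
  + 2 * (+ d * + rem m n) - + d * + m + + d * + m * δ m n
    ≡⟨ ring (+ d) (+ m) (+ rem m n) (δ m n) ⟩
  + d * Q m n ∎
  where
  ring : ∀ d m r z → + 2 * (d * r) - d * m + d * m * z ≡ d * (+ 2 * r - m + m * z)
  ring = solve-∀

Q-odd : ∀ m .{{_ : NonZero m}} n → Q m (- n) ≡ - Q m n
Q-odd m n = cases (rem m n) refl
  where
  n≡ : ∀ {r} → rem m n ≡ r → n ≡ + r mod m
  n≡ eq = subst (λ r → n ≡ + r mod m) eq (rem-mod m n)
  ring₁ : ∀ r o → - (1ℤ + r) ≡ (1ℤ + o) + - 1ℤ * ((1ℤ + (1ℤ + r)) + o)
  ring₁ = solve-∀
  ring₂ : ∀ r o → + 2 * (1ℤ + o) - ((1ℤ + (1ℤ + r)) + o) ≡ - (+ 2 * (1ℤ + r) - ((1ℤ + (1ℤ + r)) + o))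
  ring₂ = solve-∀
  cases : ∀ r → rem m n ≡ r → Q m (- n) ≡ - Q m n
  cases zero    eq = trans (Q-rem-zero m (- n) (rem-unique (subst (ℕ._< m) eq (rem-< m n)) (mod-neg (n≡ eq))))
                           (sym (cong -_ (Q-rem-zero m n eq)))
  -- Here o = m - r - 2, so that `suc o` is the residue m - (r + 1) of -n, obtained without
  -- truncated subtraction.
  cases (suc r) eq with o , m≡ ← ℕ.m≤n⇒∃[o]m+o≡n (subst (ℕ._< m) eq (rem-< m n)) = begin
    Q m (- n)                                      ≡⟨ Q-rem-suc m (- n) (rem-unique o<m (mod-trans (mod-neg (n≡ eq)) (- 1ℤ , wrap))) ⟩
    + 2 * + suc o - + m                            ≡⟨ cong (λ k → + 2 * + suc o - + k) m≡ ⟨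
    + 2 * + suc o - + (suc (suc r) ℕ.+ o)          ≡⟨ ring₂ (+ r) (+ o) ⟩
    - (+ 2 * + suc r - + (suc (suc r) ℕ.+ o))      ≡⟨ cong (λ k → - (+ 2 * + suc r - + k)) m≡ ⟩
    - (+ 2 * + suc r - + m)                        ≡⟨ cong -_ (Q-rem-suc m n eq) ⟨
    - Q m n                                        ∎
    where
    o<m : suc o ℕ.< m
    o<m = subst (suc o ℕ.<_) m≡ (s≤s (s≤s (ℕ.m≤n+m o r)))
    wrap : - + suc r ≡ + suc o + - 1ℤ * + m
    wrap = trans (ring₁ (+ r) (+ o)) (cong (λ k → + suc o + - 1ℤ * + k) m≡)

-- The term with `δ` is the wrap from residue 0 to m - 1.
rem-pred : ∀ m .{{_ : NonZero m}} n → + rem m (n - 1ℤ) ≡ + rem m n - 1ℤ + + m * δ m n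
rem-pred m@(suc p) n with rem m n | rem-< m n | rem-mod m n
... | zero  | _       | n≡r = trans (cong +_ (rem-unique (ℕ.n<1+n p) (mod-trans (mod-+ʳ (- 1ℤ) n≡r) (- 1ℤ , ring (+ p))))) (ring′ (+ p))
  where
  ring : ∀ p → 0ℤ - 1ℤ ≡ p + - 1ℤ * (1ℤ + p)
  ring = solve-∀
  ring′ : ∀ p → p ≡ 0ℤ - 1ℤ + (1ℤ + p) * 1ℤ
  ring′ = solve-∀
... | suc r | r<m | n≡r = trans (cong +_ (rem-unique (ℕ.<-trans (ℕ.n<1+n r) r<m) (subst (λ z → n - 1ℤ ≡ z mod m) (ring (+ r)) (mod-+ʳ (- 1ℤ) n≡r)))) (ring′ (+ r) (+ m))
  where
  ring : ∀ r → (1ℤ + r) - 1ℤ ≡ r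
  ring = solve-∀
  ring′ : ∀ r m → r ≡ (1ℤ + r) - 1ℤ + m * 0ℤ
  ring′ = solve-∀

-- Moments of the sawtooth over a period

sum-Q : ∀ m → sum m (Q m) ≡ 0ℤ
sum-Q zero = refl
sum-Q (suc p) = begin
  sum (suc p) (Q (suc p))                                          ≡⟨ sum-suc p (Q (suc p)) ⟩
  Q (suc p) 0ℤ + sum p (λ x → Q (suc p) (x + 1ℤ))                  ≡⟨ cong₂ _+_ (Q-zero (suc p)) (sum-cong-< p (Q-suc p)) ⟩
  -- With m = p + 1, the values beyond 0 are 2 - m, 4 - m, ..., m - 2, a progression symmetric about
  -- 0.
  0ℤ + sum p (λ x → + 2 * (1ℤ * x) + (1ℤ - + p))                   ≡⟨ cong (λ z → 0ℤ + z) (sum-affine p 1ℤ (1ℤ - + p)) ⟩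
  0ℤ + (1ℤ * (+ p * (+ p - 1ℤ)) + + p * (1ℤ - + p))                ≡⟨ ring (+ p) ⟩
  0ℤ                                                               ∎
  where
  ring : ∀ p → 0ℤ + (1ℤ * (p * (p - 1ℤ)) + p * (1ℤ - p)) ≡ 0ℤ
  ring = solve-∀
  ring′ : ∀ j p → + 2 * (1ℤ + j) - (1ℤ + p) ≡ + 2 * (1ℤ * j) + (1ℤ - p)
  ring′ = solve-∀
  Q-suc : ∀ p j → j ℕ.< p → Q (suc p) (+ j + 1ℤ) ≡ + 2 * (1ℤ * + j) + (1ℤ - + p)
  Q-suc p j j<p = trans (cong (λ k → Q (suc p) (+ k)) (ℕ.+-comm j 1)) (trans (Q-small (s≤s j<p)) (ring′ (+ j) (+ p)))

sum-Q² : ∀ m → + 3 * sum m (λ x → Q m x * Q m x) ≡ + m * (+ m - 1ℤ) * (+ m - + 2)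
sum-Q² zero = refl
sum-Q² (suc p) = begin
  + 3 * sum (suc p) (λ x → Q (suc p) x * Q (suc p) x)
    ≡⟨ cong (+ 3 *_) (sum-suc p (λ x → Q (suc p) x * Q (suc p) x)) ⟩
  + 3 * (Q (suc p) 0ℤ * Q (suc p) 0ℤ + sum p (λ x → Q (suc p) (x + 1ℤ) * Q (suc p) (x + 1ℤ)))
    ≡⟨ cong (+ 3 *_) (cong₂ _+_ (cong (λ z → z * z) (Q-zero (suc p))) (sum-cong-< p λ j j<p → cong (λ z → z * z) (Q-suc p j j<p))) ⟩
  + 3 * (0ℤ * 0ℤ + sum p (square (+ suc p)))
    ≡⟨ ring₁ (sum p (square (+ suc p))) ⟩
  + 3 * sum p (square (+ suc p))
    ≡⟨ closed p (+ suc p) ⟩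
  + 2 * + p * (1ℤ + + p) * (+ 2 * + p + 1ℤ) - + 6 * + suc p * + p * (1ℤ + + p) + + 3 * + p * (+ suc p * + suc p)
    ≡⟨ ring₂ (+ p) ⟩
  + suc p * (+ suc p - 1ℤ) * (+ suc p - + 2) ∎
  where
  square : ℤ → ℤ → ℤ
  square v x = (+ 2 * (1ℤ + x) - v) * (+ 2 * (1ℤ + x) - v)
  Q-suc : ∀ p j → j ℕ.< p → Q (suc p) (+ j + 1ℤ) ≡ + 2 * (1ℤ + + j) - + suc p
  Q-suc p j j<p = trans (cong (λ k → Q (suc p) (+ k)) (ℕ.+-comm j 1)) (Q-small (s≤s j<p))
  ring₁ : ∀ s → + 3 * (0ℤ * 0ℤ + s) ≡ + 3 * s
  ring₁ = solve-∀
  ring₂ : ∀ p → + 2 * p * (1ℤ + p) * (+ 2 * p + 1ℤ) - + 6 * (1ℤ + p) * p * (1ℤ + p) + + 3 * p * ((1ℤ + p) * (1ℤ + p)) ≡ (1ℤ + p) * ((1ℤ + p) - 1ℤ) * ((1ℤ + p) - + 2)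
  ring₂ = solve-∀
  ring₃ : ∀ p v → + 2 * p * (1ℤ + p) * (+ 2 * p + 1ℤ) - + 6 * v * p * (1ℤ + p) + + 3 * p * (v * v) + + 3 * ((+ 2 * (1ℤ + p) - v) * (+ 2 * (1ℤ + p) - v))
    ≡ + 2 * (1ℤ + p) * (1ℤ + (1ℤ + p)) * (+ 2 * (1ℤ + p) + 1ℤ) - + 6 * v * (1ℤ + p) * (1ℤ + (1ℤ + p)) + + 3 * (1ℤ + p) * (v * v)
  ring₃ = solve-∀
  ring₄ : ∀ v → 0ℤ ≡ + 2 * 0ℤ * (1ℤ + 0ℤ) * (+ 2 * 0ℤ + 1ℤ) - + 6 * v * 0ℤ * (1ℤ + 0ℤ) + + 3 * 0ℤ * (v * v)
  ring₄ = solve-∀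
  -- The subtrahend v is freed from p, since otherwise the summand would change in the induction.
  -- The right-hand side is 12 Σ y² - 12 v Σ y + 3 p v² over y = 1, ..., p.
  closed : ∀ p v → + 3 * sum p (square v) ≡
    + 2 * + p * (1ℤ + + p) * (+ 2 * + p + 1ℤ) - + 6 * v * + p * (1ℤ + + p) + + 3 * + p * (v * v)
  closed zero    v = ring₄ v
  closed (suc p) v = trans (ℤ.*-distribˡ-+ (+ 3) (sum p (square v)) (square v (+ p)))
    (trans (cong (_+ + 3 * square v (+ p)) (closed p v)) (ring₃ (+ p) v))

-- This is the replication formula Σ ((x + i/d)) = ((dx)), i modulo d, at x = r/(md). As r < m, the
-- arguments r + m i are already reduced modulo m d; the class r = 0 is separate because it contains
-- the zero of `Q`.
sum-Q-fibre : ∀ m d .{{_ : NonZero m}} .{{_ : NonZero d}} r → r ℕ.< m →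
  sum d (λ i → Q (m ℕ.* d) (+ r + + m * i)) ≡ + d * Q m (+ r)
sum-Q-fibre m d zero r<m = begin
  sum d (λ i → Q (m ℕ.* d) (0ℤ + + m * i))   ≡⟨ sum-cong d (λ i → trans (cong (Q (m ℕ.* d)) (ℤ.+-identityˡ (+ m * i))) (Q-scale m d i)) ⟩
  sum d (λ i → + m * Q d i)                  ≡⟨ sum-*ˡ d (+ m) (Q d) ⟩
  + m * sum d (Q d)                          ≡⟨ cong (+ m *_) (sum-Q d) ⟩
  + m * 0ℤ                                   ≡⟨ trans (ℤ.*-zeroʳ (+ m)) (sym (ℤ.*-zeroʳ (+ d))) ⟩
  + d * 0ℤ                                   ≡⟨ cong (+ d *_) (Q-zero m) ⟨
  + d * Q m 0ℤ                               ∎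
sum-Q-fibre m d (suc r) r<m = begin
  sum d (λ i → Q (m ℕ.* d) (+ suc r + + m * i))           ≡⟨ sum-cong-< d value ⟩
  sum d (λ i → + 2 * (+ m * i) + (+ 2 * + suc r - + m * + d))   ≡⟨ sum-affine d (+ m) _ ⟩
  + m * (+ d * (+ d - 1ℤ)) + + d * (+ 2 * + suc r - + m * + d)  ≡⟨ ring (+ m) (+ d) (+ suc r) ⟩
  + d * (+ 2 * + suc r - + m)                             ≡⟨ cong (+ d *_) (Q-small r<m) ⟨
  + d * Q m (+ suc r)                                     ∎
  where
  ring : ∀ m d r → m * (d * (d - 1ℤ)) + d * (+ 2 * r - m * d) ≡ d * (+ 2 * r - m)
  ring = solve-∀
  ring′ : ∀ m d r i → + 2 * (r + m * i) - m * d ≡ + 2 * (m * i) + (+ 2 * r - m * d)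
  ring′ = solve-∀
  bound : ∀ i → i ℕ.< d → suc r ℕ.+ m ℕ.* i ℕ.< m ℕ.* d
  bound i i<d = ℕ.<-≤-trans (ℕ.+-monoˡ-< (m ℕ.* i) r<m)
    (ℕ.≤-trans (ℕ.≤-reflexive (sym (ℕ.*-suc m i))) (ℕ.*-monoʳ-≤ m i<d))
  value : ∀ i → i ℕ.< d → Q (m ℕ.* d) (+ suc r + + m * + i) ≡ + 2 * (+ m * + i) + (+ 2 * + suc r - + m * + d)
  value i i<d = begin
    Q (m ℕ.* d) (+ suc r + + m * + i)               ≡⟨ cong (λ z → Q (m ℕ.* d) (+ suc r + z)) (sym (ℤ.pos-* m i)) ⟩
    Q (m ℕ.* d) (+ suc (r ℕ.+ m ℕ.* i))             ≡⟨ Q-small (bound i i<d) ⟩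
    + 2 * (+ suc r + + (m ℕ.* i)) - + (m ℕ.* d)     ≡⟨ cong₂ (λ x y → + 2 * (+ suc r + x) - y) (ℤ.pos-* m i) (ℤ.pos-* m d) ⟩
    + 2 * (+ suc r + + m * + i) - + m * + d         ≡⟨ ring′ (+ m) (+ d) (+ suc r) (+ i) ⟩
    + 2 * (+ m * + i) + (+ 2 * + suc r - + m * + d) ∎

-- The three-term law

-- This is 4m² s(b,c;m), the Dedekind-Rademacher sum with its denominators cleared.
H : ℕ → ℤ → ℤ → ℤ
H m b c = sum m (λ j → Q m (b * j) * Q m (c * j))

-- The equation n n′ = 1 + k m is a Bézout relation, so -k inverts m modulo n.
unit-sym : ∀ {m n} → UnitMod m (+ n) → UnitMod n (+ m)
unit-sym {m} {n} (n′ , (k , eq)) = - k , (- n′ , (begin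
  + m * - k               ≡⟨ ring₁ (+ m) k ⟩
  1ℤ - (1ℤ + k * + m)     ≡⟨ cong (λ z → 1ℤ - z) eq ⟨
  1ℤ - + n * n′           ≡⟨ ring₂ (+ n) n′ ⟩
  1ℤ + - n′ * + n         ∎))
  where
  ring₁ : ∀ m k → m * - k ≡ 1ℤ - (1ℤ + k * m)
  ring₁ = solve-∀
  ring₂ : ∀ n n′ → 1ℤ - n * n′ ≡ 1ℤ + - n′ * n
  ring₂ = solve-∀

-- Substitute k = b j, which permutes the residues, and note c j ≡ x (b j). The functions are
-- arbitrary because the lemma serves `Q` in `H-normalise` and `δ` in `sum-δδδ`.
sum-pair-dilate : ∀ m .{{_ : NonZero m}} {f g} → Periodic m f → Periodic m g →
  ∀ b c x → UnitMod m b → b * x ≡ c mod m →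
  sum m (λ j → f (b * j) * g (c * j)) ≡ sum m (λ j → f j * g (x * j))
sum-pair-dilate m {f} {g} perf perg b c x unit bx≡c = begin
  sum m (λ j → f (b * j) * g (c * j))         ≡⟨ sum-cong m (λ j → cong (f (b * j) *_) (perg (swap j))) ⟩
  sum m (λ j → f (b * j) * g (x * (b * j)))   ≡⟨ sum-dilate m (λ k → f k * g (x * k)) (λ e → cong₂ _*_ (perf e) (perg (mod-*ˡ x e))) b unit ⟩
  sum m (λ j → f j * g (x * j))               ∎
  where
  ring : ∀ b x j → b * x * j ≡ x * (b * j)
  ring = solve-∀
  swap : ∀ j → c * j ≡ x * (b * j) mod m
  swap j = subst (λ z → c * j ≡ z mod m) (ring b x j) (mod-*ʳ j (mod-sym bx≡c))

-- Only the ratio c/b modulo m matters; this brings the sums of the three-term law to classical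
-- Dedekind form.
H-normalise : ∀ m .{{_ : NonZero m}} b c x → UnitMod m b → b * x ≡ c mod m → H m b c ≡ H m 1ℤ x
H-normalise m b c x unit bx≡c = trans
  (sum-pair-dilate m (Q-periodic m) (Q-periodic m) b c x unit bx≡c)
  (sum-cong m λ j → cong (λ z → Q m z * Q m (x * j)) (sym (ℤ.*-identityˡ j)))

H-neg : ∀ m .{{_ : NonZero m}} b x → H m b (- x) ≡ - H m b x
H-neg m b x = trans (sum-cong m λ j → begin
  Q m (b * j) * Q m (- x * j)    ≡⟨ cong (λ z → Q m (b * j) * Q m z) (sym (ℤ.neg-distribˡ-* x j)) ⟩
  Q m (b * j) * Q m (- (x * j))  ≡⟨ cong (Q m (b * j) *_) (Q-odd m (x * j)) ⟩
  Q m (b * j) * - Q m (x * j)    ≡⟨ sym (ℤ.neg-distribʳ-* (Q m (b * j)) (Q m (x * j))) ⟩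
  - (Q m (b * j) * Q m (x * j))  ∎) (sum-neg m (λ j → Q m (b * j) * Q m (x * j)))

H-zero : ∀ m b → H m b 0ℤ ≡ 0ℤ
H-zero m b = sum-zero m λ j → trans (cong (Q m (b * j) *_) (Q-zero m)) (ℤ.*-zeroʳ (Q m (b * j)))

-- Sums over the common grid of three moduli

module _ (a b c : ℕ) .{{_ : NonZero a}} .{{_ : NonZero b}} .{{_ : NonZero c}} where

  -- The fraction K j / M equals b j / a; its common factor c is exposed for `Q-scale` and `δ-scale`
  -- alike, hence the arbitrary G.
  at-multiple : ∀ (G : ℕ → ℤ → ℤ) {M K} → M ≡ a ℕ.* c → K ≡ b ℕ.* c →
    ∀ j → G M (+ K * j) ≡ G (c ℕ.* a) (+ c * (+ b * j))
  at-multiple G refl refl j = cong₂ G (ℕ.*-comm a c) (trans (cong (_* j) (ℤ.pos-* b c)) (ring (+ b) (+ c) j))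
    where
    ring : ∀ b c j → b * c * j ≡ c * (b * j)
    ring = solve-∀

  Q-at-multiple : ∀ {M K} → M ≡ a ℕ.* c → K ≡ b ℕ.* c → ∀ j → Q M (+ K * j) ≡ + c * Q a (+ b * j)
  Q-at-multiple M≡ K≡ j = trans (at-multiple Q M≡ K≡ j) (Q-scale c a (+ b * j))

  δ-at-multiple : ∀ {M K} → M ≡ a ℕ.* c → K ≡ b ℕ.* c → ∀ j → δ M (+ K * j) ≡ δ a (+ b * j)
  δ-at-multiple M≡ K≡ j = trans (at-multiple δ M≡ K≡ j) (δ-scale c a (+ b * j))

-- A, B, C and N are parameters constrained by equations, rather than the
-- products themselves, so that permuting a, b, c permutes A, B, C.
module Moments (a b c : ℕ) .{{_ : NonZero a}} .{{_ : NonZero b}} .{{_ : NonZero c}}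
  {A B C N : ℕ} (A≡ : A ≡ b ℕ.* c) (B≡ : B ≡ a ℕ.* c) (C≡ : C ≡ a ℕ.* b) (N≡ : N ≡ a ℕ.* A) where

  private instance
    A≢0 : NonZero A
    A≢0 = subst NonZero (sym A≡) (ℕ.m*n≢0 b c)

  A≡′ : A ≡ c ℕ.* b
  A≡′ = trans A≡ (ℕ.*-comm b c)

  sum-multiples : (h : ℤ → ℤ) → sum N (λ n → δ A n * h n) ≡ sum a (λ j → h (+ A * j))
  sum-multiples h = trans (cong (λ N → sum N (λ n → δ A n * h n)) N≡) (sum-δ-multiples a A h)

  -- Write n = r + a k. For fixed r the two factors have the coprime periods c and b in k, so the
  -- sum over k modulo bc splits, and the replication formula evaluates the two parts as c `Q a r`
  -- and b `Q a r`.
  sum-QQ : UnitMod b (+ c) →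
    sum N (λ n → Q B n * Q C n) ≡ + b * + c * sum a (λ r → Q a r * Q a r)
  sum-QQ unit = begin
    sum N (λ n → Q B n * Q C n)
      ≡⟨ cong (λ N → sum N (λ n → Q B n * Q C n)) (trans N≡ (trans (ℕ.*-comm a A) (cong (ℕ._* a) A≡))) ⟩
    sum (b ℕ.* c ℕ.* a) (λ n → Q B n * Q C n)
      ≡⟨ sum-blocks (b ℕ.* c) a (λ n → Q B n * Q C n) ⟩
    sum (b ℕ.* c) (λ k → sum a (λ r → Q B (r + + a * k) * Q C (r + + a * k)))
      ≡⟨ sum-swap (b ℕ.* c) a (λ k r → Q B (r + + a * k) * Q C (r + + a * k)) ⟩
    sum a (λ r → sum (b ℕ.* c) (λ k → Q B (r + + a * k) * Q C (r + + a * k)))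
      ≡⟨ sum-cong a (λ r → sum-crt c b (λ k → Q B (r + + a * k)) (λ k → Q C (r + + a * k)) (fibre B≡ r) (fibre C≡ r) unit) ⟩
    sum a (λ r → sum c (λ k → Q B (r + + a * k)) * sum b (λ k → Q C (r + + a * k)))
      ≡⟨ sum-cong-< a (λ r r<a → cong₂ _*_ (fibre-sum c B≡ r r<a) (fibre-sum b C≡ r r<a)) ⟩
    sum a (λ r → (+ c * Q a r) * (+ b * Q a r))
      ≡⟨ sum-cong a (λ r → ring (+ b) (+ c) (Q a r)) ⟩
    sum a (λ r → + b * + c * (Q a r * Q a r))
      ≡⟨ sum-*ˡ a (+ b * + c) (λ r → Q a r * Q a r) ⟩
    + b * + c * sum a (λ r → Q a r * Q a r) ∎
    where
    ring : ∀ b c q → (c * q) * (b * q) ≡ b * c * (q * q)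
    ring = solve-∀
    fibre : ∀ {d M} → M ≡ a ℕ.* d → ∀ r → Periodic d (λ k → Q M (r + + a * k))
    fibre refl r e = Q-periodic _ (mod-+ˡ r (mod-scale a e))
    fibre-sum : ∀ d .{{_ : NonZero d}} {M} → M ≡ a ℕ.* d → ∀ r → r ℕ.< a →
      sum d (λ k → Q M (+ r + + a * k)) ≡ + d * Q a (+ r)
    fibre-sum d refl r r<a = sum-Q-fibre a d r r<a

  -- The Dedekind sums enter here: at n = A j the other two sawtooth functions are evaluated at b j
  -- / a and c j / a.
  sum-δQQ : sum N (λ n → δ A n * (Q B n * Q C n)) ≡ + b * + c * H a (+ b) (+ c)
  sum-δQQ = begin
    sum N (λ n → δ A n * (Q B n * Q C n))
      ≡⟨ sum-multiples (λ n → Q B n * Q C n) ⟩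
    sum a (λ j → Q B (+ A * j) * Q C (+ A * j))
      ≡⟨ sum-cong a (λ j → cong₂ _*_ (Q-at-multiple a b c B≡ A≡ j) (Q-at-multiple a c b C≡ A≡′ j)) ⟩
    sum a (λ j → (+ c * Q a (+ b * j)) * (+ b * Q a (+ c * j)))
      ≡⟨ sum-cong a (λ j → ring (+ b) (+ c) (Q a (+ b * j)) (Q a (+ c * j))) ⟩
    sum a (λ j → + b * + c * (Q a (+ b * j) * Q a (+ c * j)))
      ≡⟨ sum-*ˡ a (+ b * + c) (λ j → Q a (+ b * j) * Q a (+ c * j)) ⟩
    + b * + c * H a (+ b) (+ c) ∎
    where
    ring : ∀ b c x y → (c * x) * (b * y) ≡ b * c * (x * y)
    ring = solve-∀

  sum-δA : sum N (δ A) ≡ + a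
  sum-δA = begin
    sum N (δ A)                 ≡⟨ sum-cong N (λ n → sym (ℤ.*-identityʳ (δ A n))) ⟩
    sum N (λ n → δ A n * 1ℤ)    ≡⟨ sum-multiples (λ _ → 1ℤ) ⟩
    sum a (λ _ → 1ℤ)            ≡⟨ sum-const a 1ℤ ⟩
    + a * 1ℤ                    ≡⟨ ℤ.*-identityʳ (+ a) ⟩
    + a                         ∎

  -- A multiple A j of A is a multiple of B only if a divides b j, hence j; within one period this
  -- leaves n = 0.
  sum-δδ : UnitMod a (+ b) → sum N (λ n → δ A n * δ B n) ≡ 1ℤ
  sum-δδ unit = begin
    sum N (λ n → δ A n * δ B n)     ≡⟨ sum-multiples (δ B) ⟩
    sum a (λ j → δ B (+ A * j))     ≡⟨ sum-cong a (δ-at-multiple a b c B≡ A≡) ⟩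
    sum a (λ j → δ a (+ b * j))     ≡⟨ sum-dilate a (δ a) (δ-periodic a) (+ b) unit ⟩
    sum a (δ a)                     ≡⟨ sum-cong a (λ n → sym (ℤ.*-identityʳ (δ a n))) ⟩
    sum a (λ n → δ a n * 1ℤ)        ≡⟨ sum-δ a (λ _ → 1ℤ) ⟩
    1ℤ                              ∎

  -- Dilating by the inverse of b turns one factor into `δ a j`, which leaves j = 0, where the other
  -- factor is 1.
  sum-δδδ : UnitMod a (+ b) → sum N (λ n → δ A n * (δ B n * δ C n)) ≡ 1ℤ
  sum-δδδ unit@(b′ , bb′) = begin
    sum N (λ n → δ A n * (δ B n * δ C n))
      ≡⟨ sum-multiples (λ n → δ B n * δ C n) ⟩
    sum a (λ j → δ B (+ A * j) * δ C (+ A * j))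
      ≡⟨ sum-cong a (λ j → cong₂ _*_ (δ-at-multiple a b c B≡ A≡ j) (δ-at-multiple a c b C≡ A≡′ j)) ⟩
    sum a (λ j → δ a (+ b * j) * δ a (+ c * j))
      ≡⟨ sum-pair-dilate a (δ-periodic a) (δ-periodic a) (+ b) (+ c) (b′ * + c) unit b⁻¹c ⟩
    sum a (λ j → δ a j * δ a (b′ * + c * j))
      ≡⟨ sum-δ a (λ j → δ a (b′ * + c * j)) ⟩
    δ a (b′ * + c * 0ℤ)
      ≡⟨ cong (δ a) (ℤ.*-zeroʳ (b′ * + c)) ⟩
    δ a 0ℤ
      ≡⟨ cong isZero (rem-small (ℕ.>-nonZero⁻¹ a)) ⟩
    1ℤ ∎
    where
    b⁻¹c : + b * (b′ * + c) ≡ + c mod a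
    b⁻¹c = subst₂ (λ x y → x ≡ y mod a) (ℤ.*-assoc (+ b) b′ (+ c)) (ℤ.*-identityˡ (+ c)) (mod-*ʳ (+ c) bb′)

sum-linear₃ : ∀ n u v w (f g h : ℤ → ℤ) →
  sum n (λ x → u * f x + v * g x + w * h x) ≡ u * sum n f + v * sum n g + w * sum n h
sum-linear₃ n u v w f g h = begin
  sum n (λ x → u * f x + v * g x + w * h x)
    ≡⟨ sum-+ n (λ x → u * f x + v * g x) (λ x → w * h x) ⟩
  sum n (λ x → u * f x + v * g x) + sum n (λ x → w * h x)
    ≡⟨ cong (_+ sum n (λ x → w * h x)) (sum-+ n (λ x → u * f x) (λ x → v * g x)) ⟩
  sum n (λ x → u * f x) + sum n (λ x → v * g x) + sum n (λ x → w * h x)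
    ≡⟨ cong₂ _+_ (cong₂ _+_ (sum-*ˡ n u f) (sum-*ˡ n v g)) (sum-*ˡ n w h) ⟩
  u * sum n f + v * sum n g + w * sum n h ∎

-- P m n = 2m (((n + ½)/m))
P : ℕ → ℤ → ℤ
P m n = + 2 * + rem m n + 1ℤ - + m

P-periodic : ∀ m → Periodic m (P m)
P-periodic m x≡y = cong (λ r → + 2 * + r + 1ℤ - + m) (rem-cong m x≡y)

-- Half a step to the right raises 2m ((n/m)) by 1 through the slope and, at a multiple of m, lowers
-- it by m, half of the jump. `P-left` is the mirror image.
P-right : ∀ m n → P m n ≡ Q m n + (1ℤ - + m * δ m n)
P-right m n = ring (+ rem m n) (+ m) (δ m n)
  where
  ring : ∀ r m d → + 2 * r + 1ℤ - m ≡ (+ 2 * r - m + m * d) + (1ℤ - m * d)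
  ring = solve-∀

P-left : ∀ m .{{_ : NonZero m}} n → P m (n - 1ℤ) ≡ Q m n - (1ℤ - + m * δ m n)
P-left m n = trans (cong (λ r → + 2 * r + 1ℤ - + m) (rem-pred m n)) (ring (+ rem m n) (+ m) (δ m n))
  where
  ring : ∀ r m d → + 2 * (r - 1ℤ + m * d) + 1ℤ - m ≡ (+ 2 * r - m + m * d) - (1ℤ - m * d)
  ring = solve-∀

mod-multiple : ∀ {x y N} d m → N ≡ d ℕ.* m → x ≡ y mod N → x ≡ y mod m
mod-multiple {y = y} d m refl (k , refl) = k * + d , trans (cong (λ z → y + k * z) (ℤ.pos-* d m)) (ring y k (+ d) (+ m))
  where
  ring : ∀ y k d m → y + k * (d * m) ≡ y + k * d * m
  ring = solve-∀

-- Rademacher's three-term law, with denominators cleared.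
ThreeTerm : (a b c x y z : ℤ) → Set
ThreeTerm a b c x y z =
  + 3 * (b * b * (c * c) * x + a * a * (c * c) * y + a * a * (b * b) * z) ≡
  a * b * c * (a * a + b * b + c * c) - + 3 * (a * b * c * (a * b * c))

module Reciprocity (a b c : ℕ) .{{_ : NonZero a}} .{{_ : NonZero b}} .{{_ : NonZero c}}
  (a⊥b : UnitMod a (+ b)) (a⊥c : UnitMod a (+ c)) (b⊥c : UnitMod b (+ c)) where

  -- On the grid x = n/(abc) the functions ((ax)), ((bx)), ((cx)) become ((n/A)), ((n/B)), ((n/C)),
  -- and N is the period in n.
  A B C N : ℕ
  A = b ℕ.* c
  B = a ℕ.* c
  C = a ℕ.* b
  N = a ℕ.* A

  private instance
    A≢0 : NonZero A
    A≢0 = ℕ.m*n≢0 b c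
    B≢0 : NonZero B
    B≢0 = ℕ.m*n≢0 a c
    C≢0 : NonZero C
    C≢0 = ℕ.m*n≢0 a b

  N≡bB : N ≡ b ℕ.* B
  N≡bB = begin
    a ℕ.* (b ℕ.* c) ≡⟨ ℕ.*-assoc a b c ⟨
    a ℕ.* b ℕ.* c   ≡⟨ cong (ℕ._* c) (ℕ.*-comm a b) ⟩
    b ℕ.* a ℕ.* c   ≡⟨ ℕ.*-assoc b a c ⟩
    b ℕ.* (a ℕ.* c) ∎

  N≡cC : N ≡ c ℕ.* C
  N≡cC = trans (sym (ℕ.*-assoc a b c)) (ℕ.*-comm C c)

  -- The unprimed instances put each modulus first in turn. As `sum-δδ` couples the first modulus
  -- with the second, the pairs (A, C) and (B, C) are covered by `Ma′` and `Mb′`.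
  module Ma  = Moments a b c {A} {B} {C} {N} refl refl refl refl
  module Ma′ = Moments a c b {A} {C} {B} {N} (ℕ.*-comm b c) refl refl refl
  module Mb  = Moments b a c {B} {A} {C} {N} refl refl (ℕ.*-comm a b) N≡bB
  module Mb′ = Moments b c a {B} {C} {A} {N} (ℕ.*-comm a c) (ℕ.*-comm a b) refl N≡bB
  module Mc  = Moments c a b {C} {A} {B} {N} refl (ℕ.*-comm b c) (ℕ.*-comm a c) N≡cC

  -- Up to the factor 8ABC, this is ((ax)) ((bx)) ((cx)) at the midpoint x = (n + ½)/(abc), away
  -- from every jump.
  F : ℤ → ℤ
  F n = P A n * P B n * P C n

  F-periodic : Periodic N F
  F-periodic e = cong₂ _*_ (cong₂ _*_
    (P-periodic A (mod-multiple a A refl e)) (P-periodic B (mod-multiple b B N≡bB e)))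
    (P-periodic C (mod-multiple c C N≡cC e))

  -- Half the increment of `F` at n, sorted by type of monomial so that each group is summed by its
  -- own lemma of `Moments`; the constant 1 joins the triple product in `E₅`.
  E₁ E₂ E₃ E₄ E₅ E : ℤ → ℤ
  E₁ n = 1ℤ * (Q B n * Q C n) + 1ℤ * (Q A n * Q C n) + 1ℤ * (Q A n * Q B n)
  E₂ n = - + A * (δ A n * (Q B n * Q C n)) + - + B * (δ B n * (Q A n * Q C n)) + - + C * (δ C n * (Q A n * Q B n))
  E₃ n = - + A * δ A n + - + B * δ B n + - + C * δ C n
  E₄ n = + A * + B * (δ A n * δ B n) + + A * + C * (δ A n * δ C n) + + B * + C * (δ B n * δ C n)
  E₅ n = 1ℤ + - (+ A * + B * + C) * (δ A n * (δ B n * δ C n))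
  E n = E₁ n + (E₂ n + (E₃ n + (E₄ n + E₅ n)))

  -- With ε = 1 - m δ the two sides of a point are Q ± ε, and
  -- Π (Q + ε) - Π (Q - ε) = 2 (ε Q′ Q″ + ε′ Q Q″ + ε″ Q Q′ + ε ε′ ε″).
  F-step : ∀ n → F n - F (n - 1ℤ) ≡ + 2 * E n
  F-step n = trans (cong₂ _-_
    (cong₂ _*_ (cong₂ _*_ (P-right A n) (P-right B n)) (P-right C n))
    (cong₂ _*_ (cong₂ _*_ (P-left A n) (P-left B n)) (P-left C n)))
    (ring (Q A n) (Q B n) (Q C n) (+ A) (+ B) (+ C) (δ A n) (δ B n) (δ C n))
    where
    ring : ∀ x y z A B C u v w →
      (x + (1ℤ - A * u)) * (y + (1ℤ - B * v)) * (z + (1ℤ - C * w)) -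
      (x - (1ℤ - A * u)) * (y - (1ℤ - B * v)) * (z - (1ℤ - C * w)) ≡
      + 2 * ((1ℤ * (y * z) + 1ℤ * (x * z) + 1ℤ * (x * y)) +
            ((- A * (u * (y * z)) + - B * (v * (x * z)) + - C * (w * (x * y))) +
            ((- A * u + - B * v + - C * w) +
            ((A * B * (u * v) + A * C * (u * w) + B * C * (v * w)) +
             (1ℤ + - (A * B * C) * (u * (v * w)))))))
    ring = solve-∀

  sum-E≡0 : sum N E ≡ 0ℤ
  sum-E≡0 = ℤ.*-cancelˡ-≡ (+ 2) (sum N E) 0ℤ (begin
    + 2 * sum N E                      ≡⟨ sum-*ˡ N (+ 2) E ⟨
    sum N (λ n → + 2 * E n)            ≡⟨ sum-cong N (λ n → sym (F-step n)) ⟩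
    sum N (λ n → F n - F (n - 1ℤ))     ≡⟨ sum-telescope N F ⟩
    F (+ N - 1ℤ) - F (0ℤ - 1ℤ)         ≡⟨ cong (_- F (0ℤ - 1ℤ)) (F-periodic (1ℤ , wrap (+ N))) ⟩
    F (0ℤ - 1ℤ) - F (0ℤ - 1ℤ)          ≡⟨ ℤ.+-inverseʳ (F (0ℤ - 1ℤ)) ⟩
    0ℤ                                 ∎)
    where
    wrap : ∀ N → N - 1ℤ ≡ (0ℤ - 1ℤ) + 1ℤ * N
    wrap = solve-∀

  qa qb qc ha hb hc : ℤ
  qa = sum a (λ r → Q a r * Q a r)
  qb = sum b (λ r → Q b r * Q b r)
  qc = sum c (λ r → Q c r * Q c r)
  ha = H a (+ b) (+ c)
  hb = H b (+ a) (+ c)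
  hc = H c (+ a) (+ b)

  -- A, B, C and N are arguments so that the casts of these products can be replaced by products in
  -- ℤ; the factors 1 keep the shape produced by `sum-linear₃` and the moment lemmas.
  evaluated : (A B C N : ℤ) → ℤ
  evaluated A B C N =
    (1ℤ * (+ b * + c * qa) + 1ℤ * (+ a * + c * qb) + 1ℤ * (+ a * + b * qc)) +
    ((- A * (+ b * + c * ha) + - B * (+ a * + c * hb) + - C * (+ a * + b * hc)) +
    ((- A * + a + - B * + b + - C * + c) +
    ((A * B * 1ℤ + A * C * 1ℤ + B * C * 1ℤ) +
     (N * 1ℤ + - (A * B * C) * 1ℤ))))

  sum-E : sum N E ≡ evaluated (+ A) (+ B) (+ C) (+ N)
  sum-E =
    trans (sum-+ N E₁ (λ n → E₂ n + (E₃ n + (E₄ n + E₅ n)))) (cong₂ _+_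
      (trans (sum-linear₃ N 1ℤ 1ℤ 1ℤ (λ n → Q B n * Q C n) (λ n → Q A n * Q C n) (λ n → Q A n * Q B n))
        (combine₃ 1ℤ 1ℤ 1ℤ (Ma.sum-QQ b⊥c) (Mb.sum-QQ a⊥c) (Mc.sum-QQ a⊥b)))
    (trans (sum-+ N E₂ (λ n → E₃ n + (E₄ n + E₅ n))) (cong₂ _+_
      (trans (sum-linear₃ N (- + A) (- + B) (- + C) (λ n → δ A n * (Q B n * Q C n)) (λ n → δ B n * (Q A n * Q C n)) (λ n → δ C n * (Q A n * Q B n)))
        (combine₃ (- + A) (- + B) (- + C) Ma.sum-δQQ Mb.sum-δQQ Mc.sum-δQQ))
    (trans (sum-+ N E₃ (λ n → E₄ n + E₅ n)) (cong₂ _+_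
      (trans (sum-linear₃ N (- + A) (- + B) (- + C) (δ A) (δ B) (δ C))
        (combine₃ (- + A) (- + B) (- + C) Ma.sum-δA Mb.sum-δA Mc.sum-δA))
    (trans (sum-+ N E₄ E₅) (cong₂ _+_
      (trans (sum-linear₃ N (+ A * + B) (+ A * + C) (+ B * + C) (λ n → δ A n * δ B n) (λ n → δ A n * δ C n) (λ n → δ B n * δ C n))
        (combine₃ (+ A * + B) (+ A * + C) (+ B * + C) (Ma.sum-δδ a⊥b) (Ma′.sum-δδ a⊥c) (Mb′.sum-δδ b⊥c)))
    (trans (sum-+ N (λ _ → 1ℤ) (λ n → - (+ A * + B * + C) * (δ A n * (δ B n * δ C n)))) (cong₂ _+_
      (sum-const N 1ℤ)
      (trans (sum-*ˡ N (- (+ A * + B * + C)) (λ n → δ A n * (δ B n * δ C n)))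
        (cong (- (+ A * + B * + C) *_) (Ma.sum-δδδ a⊥b))))))))))))
    where
    combine₃ : ∀ u v w {x y z x′ y′ z′} → x ≡ x′ → y ≡ y′ → z ≡ z′ →
      u * x + v * y + w * z ≡ u * x′ + v * y′ + w * z′
    combine₃ u v w refl refl refl = refl

  evaluated≡0 : evaluated (+ b * + c) (+ a * + c) (+ a * + b) (+ a * (+ b * + c)) ≡ 0ℤ
  evaluated≡0 = begin
    evaluated (+ b * + c) (+ a * + c) (+ a * + b) (+ a * (+ b * + c))
      ≡⟨ cong₂ (λ x y → evaluated x y (+ a * + b) (+ a * x)) (ℤ.pos-* b c) (ℤ.pos-* a c) ⟨
    evaluated (+ A) (+ B) (+ a * + b) (+ a * + A)
      ≡⟨ cong₂ (evaluated (+ A) (+ B)) (ℤ.pos-* a b) (ℤ.pos-* a A) ⟨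
    evaluated (+ A) (+ B) (+ C) (+ N)
      ≡⟨ sum-E ⟨
    sum N E
      ≡⟨ sum-E≡0 ⟩
    0ℤ ∎

  three-term : ThreeTerm (+ a) (+ b) (+ c) ha hb hc
  three-term = begin
    + 3 * (+ b * + b * (+ c * + c) * ha + + a * + a * (+ c * + c) * hb + + a * + a * (+ b * + b) * hc)
      ≡⟨ ring₁ (+ a) (+ b) (+ c) qa qb qc ha hb hc ⟩
    + b * + c * (+ 3 * qa) + + a * + c * (+ 3 * qb) + + a * + b * (+ 3 * qc) + rest (+ a) (+ b) (+ c)
      - + 3 * evaluated (+ b * + c) (+ a * + c) (+ a * + b) (+ a * (+ b * + c))
      ≡⟨ substitute (sum-Q² a) (sum-Q² b) (sum-Q² c) evaluated≡0 ⟩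
    + b * + c * (+ a * (+ a - 1ℤ) * (+ a - + 2)) + + a * + c * (+ b * (+ b - 1ℤ) * (+ b - + 2))
      + + a * + b * (+ c * (+ c - 1ℤ) * (+ c - + 2)) + rest (+ a) (+ b) (+ c) - + 3 * 0ℤ
      ≡⟨ ring₂ (+ a) (+ b) (+ c) ⟩
    + a * + b * + c * (+ a * + a + + b * + b + + c * + c) - + 3 * (+ a * + b * + c * (+ a * + b * + c)) ∎
    where
    -- Three times the part of `evaluated` free of `Q`: -3abc from `E₃`, abc(a + b + c) from `E₄`
    -- and abc - (abc)² from `E₅`.
    rest : ℤ → ℤ → ℤ → ℤ
    rest a b c = + 3 * (a * b * c * (a + b + c) - + 2 * (a * b * c) - a * b * c * (a * b * c))
    substitute : ∀ {x y z e x′ y′ z′ e′} → x ≡ x′ → y ≡ y′ → z ≡ z′ → e ≡ e′ →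
      + b * + c * x + + a * + c * y + + a * + b * z + rest (+ a) (+ b) (+ c) - + 3 * e ≡
      + b * + c * x′ + + a * + c * y′ + + a * + b * z′ + rest (+ a) (+ b) (+ c) - + 3 * e′
    substitute refl refl refl refl = refl
    ring₁ : ∀ a b c qa qb qc ha hb hc →
      + 3 * (b * b * (c * c) * ha + a * a * (c * c) * hb + a * a * (b * b) * hc) ≡
      b * c * (+ 3 * qa) + a * c * (+ 3 * qb) + a * b * (+ 3 * qc)
      + + 3 * (a * b * c * (a + b + c) - + 2 * (a * b * c) - a * b * c * (a * b * c))
      - + 3 * ((1ℤ * (b * c * qa) + 1ℤ * (a * c * qb) + 1ℤ * (a * b * qc)) +
        ((- (b * c) * (b * c * ha) + - (a * c) * (a * c * hb) + - (a * b) * (a * b * hc)) +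
        ((- (b * c) * a + - (a * c) * b + - (a * b) * c) +
        ((b * c * (a * c) * 1ℤ + b * c * (a * b) * 1ℤ + a * c * (a * b) * 1ℤ) +
         (a * (b * c) * 1ℤ + - (b * c * (a * c) * (a * b)) * 1ℤ)))))
    ring₁ = solve-∀
    ring₂ : ∀ a b c →
      b * c * (a * (a - 1ℤ) * (a - + 2)) + a * c * (b * (b - 1ℤ) * (b - + 2)) + a * b * (c * (c - 1ℤ) * (c - + 2))
      + + 3 * (a * b * c * (a + b + c) - + 2 * (a * b * c) - a * b * c * (a * b * c)) - + 3 * 0ℤ ≡
      a * b * c * (a * a + b * b + c * c) - + 3 * (a * b * c * (a * b * c))
    ring₂ = solve-∀

-- The identity with denominators cleared

H-comm : ∀ m b c → H m b c ≡ H m c b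
H-comm m b c = sum-cong m λ j → ℤ.*-comm (Q m (b * j)) (Q m (c * j))

H-modulus-one : ∀ b c → H 1 b c ≡ 0ℤ
H-modulus-one b c = sum-zero 1 λ j → cong (_* Q 1 (c * j)) (Q-rem-zero 1 (b * j) (ℕ.n<1⇒n≡0 (rem-< 1 (b * j))))

coprime⇒unit : ∀ {m n} → ℕ.gcd m n ≡ 1 → UnitMod n (+ m)
coprime⇒unit {m} {n} gcd≡1 with coprime-Bézout (gcd≡1⇒coprime gcd≡1)
... | Bézout.+- x y eq = + x , (+ y , (begin
  + m * + x             ≡⟨ ℤ.*-comm (+ m) (+ x) ⟩
  + x * + m             ≡⟨ ℤ.pos-* x m ⟨
  + (x ℕ.* m)           ≡⟨ cong +_ eq ⟨
  1ℤ + + (y ℕ.* n)      ≡⟨ cong (λ z → 1ℤ + z) (ℤ.pos-* y n) ⟩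
  1ℤ + + y * + n        ∎))
... | Bézout.-+ x y eq = - + x , (- + y , (begin
  + m * - + x           ≡⟨ ring (+ m) (+ x) ⟩
  1ℤ - (1ℤ + + x * + m) ≡⟨ cong (λ z → 1ℤ - (1ℤ + z)) (ℤ.pos-* x m) ⟨
  1ℤ - + (1 ℕ.+ x ℕ.* m) ≡⟨ cong (λ z → 1ℤ - + z) eq ⟩
  1ℤ - + (y ℕ.* n)      ≡⟨ cong (λ z → 1ℤ - z) (ℤ.pos-* y n) ⟩
  1ℤ - + y * + n        ≡⟨ cong (λ z → 1ℤ + z) (ℤ.neg-distribˡ-* (+ y) (+ n)) ⟩
  1ℤ + - + y * + n      ∎))
  where
  ring : ∀ m x → m * - x ≡ 1ℤ - (1ℤ + x * m)
  ring = solve-∀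

unit-one : ∀ m → UnitMod m 1ℤ
unit-one m = 1ℤ , (0ℤ , refl)

-- The theorem multiplied by (tqe)², with b = q e and m² S(x,m) = 3 `H m 1ℤ x`.
ScaledIdentity : (q t e : ℕ) (tstar a : ℤ) → Set
ScaledIdentity q t e tstar a =
  + 3 * H (q ℕ.* e) 1ℤ a * (+ t * + t) ≡
  ((+ q * + q - 1ℤ) * a * (+ t * + q) - + 3 * H t 1ℤ (a * + q) * (+ q * + q)
    + + 3 * H q 1ℤ (a * tstar) * (+ t * + t)) * (+ e * + e)

-- e = (a² + 1) / t.  The law for (a, b, 1) and the law for (a, t, q) share the
-- term H a 1 b = H a t q; eliminating it gives the identity.
module Identity (q t e : ℕ) .{{_ : NonZero q}} .{{_ : NonZero t}} .{{_ : NonZero e}}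
  (tstar : ℤ) (tt* : + t * tstar ≡ 1ℤ mod q) where

  b : ℕ
  b = q ℕ.* e

  private instance
    b≢0 : NonZero b
    b≢0 = ℕ.m*n≢0 q e

  positive : ∀ a .{{_ : NonZero a}} → UnitMod q (+ a) → + e * + t ≡ + a * + a + 1ℤ → ScaledIdentity q t e tstar (+ a)
  positive a q⊥a et = ℤ.*-cancelˡ-≡ (+ a * + a) _ _ {{ℤ.i*j≢0 (+ a) (+ a)}}
    (ℤ.i-j≡0⇒i≡j _ _ (trans (ring (+ a) (+ q) (+ t) (+ e) X Y U V) vanish))
    where
    X Y U V : ℤ
    X = H a 1ℤ (+ b)
    Y = H b 1ℤ (+ a)
    U = H t 1ℤ (+ a * + q)
    V = H q 1ℤ (+ a * tstar)

    a⊥q : UnitMod a (+ q)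
    a⊥q = unit-sym q⊥a

    a⊥t : UnitMod a (+ t)
    a⊥t = + e , (+ a , trans (ℤ.*-comm (+ t) (+ e)) (trans et (ℤ.+-comm (+ a * + a) 1ℤ)))

    t⊥q : UnitMod t (+ q)
    t⊥q = unit-sym (tstar , tt*)

    -- Modulo a, e t = a² + 1 ≡ 1, so q e has the inverse t q′.
    a⊥b : UnitMod a (+ b)
    a⊥b with q′ , (k , qq′) ← a⊥q = + t * q′ , (k + + a + k * + a * + a , (begin
      + b * (+ t * q′)                            ≡⟨ cong (_* (+ t * q′)) (ℤ.pos-* q e) ⟩
      + q * + e * (+ t * q′)                      ≡⟨ ring₁ (+ q) (+ e) (+ t) q′ ⟩
      + q * q′ * (+ e * + t)                      ≡⟨ cong₂ _*_ qq′ et ⟩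
      (1ℤ + k * + a) * (+ a * + a + 1ℤ)           ≡⟨ ring₂ k (+ a) ⟩
      1ℤ + (k + + a + k * + a * + a) * + a        ∎))
      where
      ring₁ : ∀ q e t q′ → q * e * (t * q′) ≡ q * q′ * (e * t)
      ring₁ = solve-∀
      ring₂ : ∀ k a → (1ℤ + k * a) * (a * a + 1ℤ) ≡ 1ℤ + (k + a + k * a * a) * a
      ring₂ = solve-∀

    tb≡q : + t * + b ≡ + q mod a
    tb≡q = + q * + a , (begin
      + t * + b                   ≡⟨ cong (+ t *_) (ℤ.pos-* q e) ⟩
      + t * (+ q * + e)           ≡⟨ ring₁ (+ t) (+ q) (+ e) ⟩
      + q * (+ e * + t)           ≡⟨ cong (+ q *_) et ⟩
      + q * (+ a * + a + 1ℤ)      ≡⟨ ring₂ (+ q) (+ a) ⟩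
      + q + + q * + a * + a       ∎)
      where
      ring₁ : ∀ t q e → t * (q * e) ≡ q * (e * t)
      ring₁ = solve-∀
      ring₂ : ∀ q a → q * (a * a + 1ℤ) ≡ q + q * a * a
      ring₂ = solve-∀

    -aaq≡q : + a * - (+ a * + q) ≡ + q mod t
    -aaq≡q = - (+ q * + e) , (begin
      + a * - (+ a * + q)                 ≡⟨ ring₁ (+ a) (+ q) ⟩
      + q - + q * (+ a * + a + 1ℤ)        ≡⟨ cong (λ z → + q - + q * z) et ⟨
      + q - + q * (+ e * + t)             ≡⟨ ring₂ (+ q) (+ e) (+ t) ⟩
      + q + - (+ q * + e) * + t           ∎)
      where
      ring₁ : ∀ a q → a * - (a * q) ≡ q - q * (a * a + 1ℤ)
      ring₁ = solve-∀
      ring₂ : ∀ q e t → q - q * (e * t) ≡ q + - (q * e) * t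
      ring₂ = solve-∀

    tat*≡a : + t * (+ a * tstar) ≡ + a mod q
    tat*≡a = subst₂ (λ x y → x ≡ y mod q) (ring (+ t) tstar (+ a)) (ℤ.*-identityˡ (+ a)) (mod-*ʳ (+ a) tt*)
      where
      ring : ∀ t s a → t * s * a ≡ t * (a * s)
      ring = solve-∀

    transport : ∀ {b b′ c x x′ y y′ z z′} → b ≡ b′ → x ≡ x′ → y ≡ y′ → z ≡ z′ →
      ThreeTerm (+ a) b c x y z → ThreeTerm (+ a) b′ c x′ y′ z′
    transport refl refl refl refl law = law

    -- Dedekind reciprocity is the three-term law with third modulus 1, whose own sum vanishes.
    law₁ : ThreeTerm (+ a) (+ q * + e) 1ℤ X Y 0ℤ
    law₁ = transport (ℤ.pos-* q e) (H-comm a (+ b) 1ℤ) (H-comm b (+ a) 1ℤ) (H-modulus-one (+ a) (+ b))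
      (Reciprocity.three-term a b 1 a⊥b (unit-one a) (unit-one b))

    -- The multipliers are the ratios q/t ≡ b modulo a, q/a ≡ -aq modulo t, and a/t ≡ a t* modulo q.
    law₂ : ThreeTerm (+ a) (+ t) (+ q) X (- U) V
    law₂ = transport refl
      (H-normalise a (+ t) (+ q) (+ b) a⊥t tb≡q)
      (trans (H-normalise t (+ a) (+ q) (- (+ a * + q)) (unit-sym a⊥t) -aaq≡q) (H-neg t 1ℤ (+ a * + q)))
      (trans (H-comm q (+ a) (+ t)) (H-normalise q (+ t) (+ a) (+ a * tstar) (tstar , tt*) tat*≡a))
      (Reciprocity.three-term a t q a⊥t a⊥q t⊥q)

    -- The factors t² and e² give X the same coefficient 3t²q²e² in both laws, so that it cancels;
    -- the last summand pays for replacing a² + 1 by e t.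
    ring : ∀ a q t e X Y U V →
      a * a * (+ 3 * Y * (t * t)) -
      a * a * (((q * q - 1ℤ) * a * (t * q) - + 3 * U * (q * q) + + 3 * V * (t * t)) * (e * e)) ≡
      t * t * (+ 3 * (q * e * (q * e) * (1ℤ * 1ℤ) * X + a * a * (1ℤ * 1ℤ) * Y + a * a * (q * e * (q * e)) * 0ℤ)
        - (a * (q * e) * 1ℤ * (a * a + q * e * (q * e) + 1ℤ * 1ℤ) - + 3 * (a * (q * e) * 1ℤ * (a * (q * e) * 1ℤ))))
      - e * e * (+ 3 * (t * t * (q * q) * X + a * a * (q * q) * - U + a * a * (t * t) * V)
        - (a * t * q * (a * a + t * t + q * q) - + 3 * (a * t * q * (a * t * q))))
      + (a * (q * q * q) * t * (e * e) - a * q * e * (t * t)) * (e * t - (a * a + 1ℤ))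
    ring = solve-∀

    vanish : _ ≡ 0ℤ
    vanish = trans (cong₂ _+_ (cong₂ _-_
        (cong (+ t * + t *_) (ℤ.i≡j⇒i-j≡0 law₁)) (cong (+ e * + e *_) (ℤ.i≡j⇒i-j≡0 law₂)))
        (cong ((+ a * (+ q * + q * + q) * + t * (+ e * + e) - + a * + q * + e * (+ t * + t)) *_) (ℤ.i≡j⇒i-j≡0 et)))
      (zeros (+ t * + t) (+ e * + e) (+ a * (+ q * + q * + q) * + t * (+ e * + e) - + a * + q * + e * (+ t * + t)))
      where
      zeros : ∀ x y z → x * 0ℤ - y * 0ℤ + z * 0ℤ ≡ 0ℤ
      zeros = solve-∀

  negate : ∀ a → ScaledIdentity q t e tstar a → ScaledIdentity q t e tstar (- a)
  negate a eq = begin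
    + 3 * H b 1ℤ (- a) * (+ t * + t)      ≡⟨ cong (λ h → + 3 * h * (+ t * + t)) (H-neg b 1ℤ a) ⟩
    + 3 * - H b 1ℤ a * (+ t * + t)        ≡⟨ ring₁ (H b 1ℤ a) (+ t * + t) ⟩
    - (+ 3 * H b 1ℤ a * (+ t * + t))      ≡⟨ cong -_ eq ⟩
    - (((+ q * + q - 1ℤ) * a * (+ t * + q) - + 3 * H t 1ℤ (a * + q) * (+ q * + q)
      + + 3 * H q 1ℤ (a * tstar) * (+ t * + t)) * (+ e * + e))
      ≡⟨ ring₂ a (+ q) (+ t) (+ e) (H t 1ℤ (a * + q)) (H q 1ℤ (a * tstar)) ⟩
    ((+ q * + q - 1ℤ) * - a * (+ t * + q) - + 3 * - H t 1ℤ (a * + q) * (+ q * + q)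
      + + 3 * - H q 1ℤ (a * tstar) * (+ t * + t)) * (+ e * + e)
      ≡⟨ cong₂ (λ u v → ((+ q * + q - 1ℤ) * - a * (+ t * + q) - + 3 * u * (+ q * + q) + + 3 * v * (+ t * + t)) * (+ e * + e))
           (odd t (+ q)) (odd q tstar) ⟩
    ((+ q * + q - 1ℤ) * - a * (+ t * + q) - + 3 * H t 1ℤ (- a * + q) * (+ q * + q)
      + + 3 * H q 1ℤ (- a * tstar) * (+ t * + t)) * (+ e * + e) ∎
    where
    odd : ∀ m .{{_ : NonZero m}} x → - H m 1ℤ (a * x) ≡ H m 1ℤ (- a * x)
    odd m x = trans (sym (H-neg m 1ℤ (a * x))) (cong (H m 1ℤ) (ℤ.neg-distribˡ-* a x))
    ring₁ : ∀ h t → + 3 * - h * t ≡ - (+ 3 * h * t)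
    ring₁ = solve-∀
    ring₂ : ∀ a q t e u v →
      - (((q * q - 1ℤ) * a * (t * q) - + 3 * u * (q * q) + + 3 * v * (t * t)) * (e * e)) ≡
      ((q * q - 1ℤ) * - a * (t * q) - + 3 * - u * (q * q) + + 3 * - v * (t * t)) * (e * e)
    ring₂ = solve-∀

  -- `positive` cancels a², so a = 0 stands apart: all multipliers are then 0 and both sides vanish.
  -- For negative a, both sides are odd in a while the hypotheses are unchanged under a ↦ -a.
  scaled-identity : ∀ a → UnitMod q (+ ∣ a ∣) → + e * + t ≡ a * a + 1ℤ → ScaledIdentity q t e tstar a
  scaled-identity (+ zero) _ _ = trans (cong (λ h → + 3 * h * (+ t * + t)) (H-zero b 1ℤ)) (trans
    (ring (+ q) (+ t) (+ e))
    (cong₂ (λ u v → ((+ q * + q - 1ℤ) * 0ℤ * (+ t * + q) - + 3 * u * (+ q * + q) + + 3 * v * (+ t * + t)) * (+ e * + e))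
      (sym (H-zero t 1ℤ)) (sym (H-zero q 1ℤ))))
    where
    ring : ∀ q t e → + 3 * 0ℤ * (t * t) ≡ ((q * q - 1ℤ) * 0ℤ * (t * q) - + 3 * 0ℤ * (q * q) + + 3 * 0ℤ * (t * t)) * (e * e)
    ring = solve-∀
  scaled-identity (+ suc n)  q⊥a et = positive (suc n) q⊥a et
  scaled-identity -[1+ n ]   q⊥a et = negate (+ suc n) (positive (suc n) q⊥a et)

-- Passage to ℚ

ι : ℤ → ℚ
ι i = i / 1

-- Among unnormalised rationals equality is cross-multiplication, so the homomorphism laws of `ι`
-- avoid any reduction by gcds.
toℚᵘ-/ : ∀ i n → toℚᵘ (i / suc n) ℚᵘ.≃ mkℚᵘ i n
toℚᵘ-/ i n = ℚ.toℚᵘ-fromℚᵘ (mkℚᵘ i n)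

ι-+ : ∀ i j → ι (i + j) ≡ ι i ℚ.+ ι j
ι-+ i j = ℚ.toℚᵘ-injective (ℚᵘ.≃-trans (toℚᵘ-/ (i + j) 0) (ℚᵘ.≃-trans
  (*≡* (ring i j))
  (ℚᵘ.≃-sym (ℚᵘ.≃-trans (ℚ.toℚᵘ-homo-+ (ι i) (ι j)) (ℚᵘ.+-cong (toℚᵘ-/ i 0) (toℚᵘ-/ j 0))))))
  where
  ring : ∀ i j → (i + j) * (1ℤ * 1ℤ) ≡ (i * 1ℤ + j * 1ℤ) * 1ℤ
  ring = solve-∀

ι-* : ∀ i j → ι (i * j) ≡ ι i ℚ.* ι j
ι-* i j = ℚ.toℚᵘ-injective (ℚᵘ.≃-trans (toℚᵘ-/ (i * j) 0) (ℚᵘ.≃-trans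
  (*≡* (ring i j))
  (ℚᵘ.≃-sym (ℚᵘ.≃-trans (ℚ.toℚᵘ-homo-* (ι i) (ι j)) (ℚᵘ.*-cong (toℚᵘ-/ i 0) (toℚᵘ-/ j 0))))))
  where
  ring : ∀ i j → (i * j) * (1ℤ * 1ℤ) ≡ (i * j) * 1ℤ
  ring = solve-∀

ι-neg : ∀ i → ι (- i) ≡ ℚ.- ι i
ι-neg i = ℚ.toℚᵘ-injective (ℚᵘ.≃-trans (toℚᵘ-/ (- i) 0)
  (ℚᵘ.≃-sym (ℚᵘ.≃-trans (ℚ.toℚᵘ-homo‿- (ι i)) (ℚᵘ.-‿cong (toℚᵘ-/ i 0)))))

ι-- : ∀ i j → ι (i - j) ≡ ι i ℚ.- ι j
ι-- i j = trans (ι-+ i (- j)) (cong (ι i ℚ.+_) (ι-neg j))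

/-*-denominator : ∀ i n .{{_ : NonZero n}} → (i / n) ℚ.* ι (+ n) ≡ ι i
/-*-denominator i n@(suc k) = ℚ.toℚᵘ-injective (ℚᵘ.≃-trans (ℚ.toℚᵘ-homo-* (i / n) (ι (+ n)))
  (ℚᵘ.≃-trans (ℚᵘ.*-cong (toℚᵘ-/ i k) (toℚᵘ-/ (+ n) 0))
  (ℚᵘ.≃-trans (*≡* (trans (ring i (+ n)) (cong (i ℤ.*_) (sym (ℤ.pos-* n 1))))) (ℚᵘ.≃-sym (toℚᵘ-/ i 0)))))
  where
  ring : ∀ i n → (i * n) * 1ℤ ≡ i * (n * 1ℤ)
  ring = solve-∀

ι-cancel : ∀ n .{{_ : NonZero n}} {p r} → p ℚ.* ι (+ n) ≡ r ℚ.* ι (+ n) → p ≡ r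
ι-cancel n {p} {r} eq = begin
  p                                  ≡⟨ lemma p ⟩
  p ℚ.* ι (+ n) ℚ.* (1ℤ / n)         ≡⟨ cong (ℚ._* (1ℤ / n)) eq ⟩
  r ℚ.* ι (+ n) ℚ.* (1ℤ / n)         ≡⟨ lemma r ⟨
  r                                  ∎
  where
  lemma : ∀ p → p ≡ p ℚ.* ι (+ n) ℚ.* (1ℤ / n)
  lemma p = begin
    p                              ≡⟨ ℚ.*-identityʳ p ⟨
    p ℚ.* ι 1ℤ                     ≡⟨ cong (p ℚ.*_) (/-*-denominator 1ℤ n) ⟨
    p ℚ.* ((1ℤ / n) ℚ.* ι (+ n))   ≡⟨ solve 3 (λ p u v → p :* (u :* v) := p :* v :* u) refl p (1ℤ / n) (ι (+ n)) ⟩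
    p ℚ.* ι (+ n) ℚ.* (1ℤ / n)     ∎

-- For x = u/v in lowest terms, v = 1 makes both sides zero; otherwise x is not an integer and x -
-- ⌊x⌋ = `rem v u` / v.
saw-reduced : ∀ x → saw x ℚ.* ι (+ 2 * + ↧ₙ x) ≡ ι (Q (↧ₙ x) (↥ x))
saw-reduced (mkℚ u zero cop) = trans (ℚ.*-zeroˡ (ι (+ 2))) (cong ι (sym (Q-rem-zero 1 u (ℕ.n<1⇒n≡0 (rem-< 1 u)))))
saw-reduced x@(mkℚ u d@(suc _) cop) = begin
  ((x ℚ.- ι f) ℚ.- ½) ℚ.* ι (+ 2 * + v)          ≡⟨ cong (((x ℚ.- ι f) ℚ.- ½) ℚ.*_) (ι-* (+ 2) (+ v)) ⟩
  ((x ℚ.- ι f) ℚ.- ½) ℚ.* (ι (+ 2) ℚ.* ι (+ v))    ≡⟨ solve 3 (λ x f v → ((x :- f) :- con ½) :* (con (ι (+ 2)) :* v) := con (ι (+ 2)) :* (x :* v :- f :* v) :- v) refl x (ι f) (ι (+ v)) ⟩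
  ι (+ 2) ℚ.* (x ℚ.* ι (+ v) ℚ.- ι f ℚ.* ι (+ v)) ℚ.- ι (+ v)
    ≡⟨ cong₂ (λ y z → ι (+ 2) ℚ.* (y ℚ.- z) ℚ.- ι (+ v)) xv (sym (ι-* f (+ v))) ⟩
  ι (+ 2) ℚ.* (ι u ℚ.- ι (f * + v)) ℚ.- ι (+ v)  ≡⟨ cong (λ y → ι (+ 2) ℚ.* y ℚ.- ι (+ v)) (ι-- u (f * + v)) ⟨
  ι (+ 2) ℚ.* ι (u - f * + v) ℚ.- ι (+ v)      ≡⟨ cong (ℚ._- ι (+ v)) (ι-* (+ 2) (u - f * + v)) ⟨
  ι (+ 2 * (u - f * + v)) ℚ.- ι (+ v)        ≡⟨ ι-- (+ 2 * (u - f * + v)) (+ v) ⟨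
  ι (+ 2 * (u - f * + v) - + v)            ≡⟨ cong (λ r → ι (+ 2 * r - + v)) u-fv ⟩
  ι (+ 2 * + rem v u - + v)                    ≡⟨ cong ι (Q-nonmultiple (rem v u) refl) ⟨
  ι (Q v u)                                        ∎
  where
  v : ℕ
  v = suc d
  f : ℤ
  f = floor x
  xv : x ℚ.* ι (+ v) ≡ ι u
  xv = trans (cong (ℚ._* ι (+ v)) (sym (ℚ.↥p/↧p≡p x))) (/-*-denominator u v)
  u≡ : u ≡ + rem v u + f * + v
  u≡ = trans (a≡a%ℕn+[a/ℕn]*n u v) (cong (λ k → + rem v u + k * + v) (sym (div-pos-is-/ℕ u v)))
  ring : ∀ r k → (r + k) - k ≡ r
  ring = solve-∀
  u-fv : u - f * + v ≡ + rem v u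
  u-fv = trans (cong (ℤ._- f * + v) u≡) (ring (+ rem v u) (f * + v))
  v∣u : rem v u ≡ 0 → v ℕ.∣ ∣ u ∣
  v∣u eq = ℕ.divides ∣ f ∣ (trans (cong ∣_∣ (trans u≡ (trans (cong (λ r → + r + f * + v) eq) (ℤ.+-identityˡ (f * + v))))) (ℤ.abs-* f (+ v)))
  Q-nonmultiple : ∀ r → rem v u ≡ r → Q v u ≡ + 2 * + rem v u - + v
  -- Residue 0 would make v ≥ 2 a common divisor of u and v. The coprimality proof is irrelevant, so
  -- v ≡ 1 is recomputed by decision.
  Q-nonmultiple zero    eq with () ← recompute (v ℕ.≟ 1) (cop (v∣u eq , ℕ.∣-refl))
  Q-nonmultiple (suc r) eq = trans (Q-rem-suc v u eq) (cong (λ r → + 2 * + r - + v) (sym eq))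

-- Reduction to lowest terms divides n and m by g; `Q-scale` restores the factor.
saw-/ : ∀ n m .{{_ : NonZero m}} → saw (n / m) ℚ.* ι (+ 2 * + m) ≡ ι (Q m n)
saw-/ n m = begin
  saw x ℚ.* ι (+ 2 * + m)                     ≡⟨ cong (λ k → saw x ℚ.* ι (+ 2 * k)) (ℚ.↧-/ n m) ⟨
  saw x ℚ.* ι (+ 2 * (+ ↧ₙ x * + g))        ≡⟨ cong (λ k → saw x ℚ.* ι k) (sym (ℤ.*-assoc (+ 2) (+ ↧ₙ x) (+ g))) ⟩
  saw x ℚ.* ι (+ 2 * + ↧ₙ x * + g)          ≡⟨ cong (saw x ℚ.*_) (ι-* (+ 2 * + ↧ₙ x) (+ g)) ⟩
  saw x ℚ.* (ι (+ 2 * + ↧ₙ x) ℚ.* ι (+ g))    ≡⟨ ℚ.*-assoc (saw x) _ _ ⟨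
  saw x ℚ.* ι (+ 2 * + ↧ₙ x) ℚ.* ι (+ g)      ≡⟨ cong (ℚ._* ι (+ g)) (saw-reduced x) ⟩
  ι (Q (↧ₙ x) (↥ x)) ℚ.* ι (+ g)                ≡⟨ ι-* (Q (↧ₙ x) (↥ x)) (+ g) ⟨
  ι (Q (↧ₙ x) (↥ x) * + g)                    ≡⟨ cong ι (ℤ.*-comm (Q (↧ₙ x) (↥ x)) (+ g)) ⟩
  ι (+ g * Q (↧ₙ x) (↥ x))                    ≡⟨ cong ι (Q-scale g (↧ₙ x) {{g≢0}} (↥ x)) ⟨
  ι (Q (g ℕ.* ↧ₙ x) (+ g * ↥ x))              ≡⟨ cong₂ (λ k i → ι (Q k i)) m≡ (trans (ℤ.*-comm (+ g) (↥ x)) (ℚ.↥-/ n m)) ⟩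
  ι (Q m n)                                     ∎
  where
  x : ℚ
  x = n / m
  g : ℕ
  g = ℕ.gcd ∣ n ∣ m
  g≢0 : NonZero g
  g≢0 = ℕ.≢-nonZero λ g≡0 → ℕ.≢-nonZero⁻¹ m (ℕ.gcd[m,n]≡0⇒n≡0 ∣ n ∣ g≡0)
  m≡ : g ℕ.* ↧ₙ x ≡ m
  m≡ = ℤ.+-injective (trans (ℤ.pos-* g (↧ₙ x)) (trans (ℤ.*-comm (+ g) (+ ↧ₙ x)) (ℚ.↧-/ n m)))

sawSum : ℤ → ℕ → ℕ → ℚ
sawSum a k zero    = 0ℚ
sawSum a k (suc j) = saw (+ suc j / suc k) ℚ.* saw ((a * + suc j) / suc k) ℚ.+ sawSum a k j

-- The left-hand sides "_" are the local function of dedekind, which cannot be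
-- named here: unification finds it, at first with the arguments suc k and k;
-- abstracting suc k then makes the two arguments independent.
go≡sawSum : ∀ a K j → _ ≡ sawSum a K j
go≡sawSum-suc : ∀ a k → _ ≡ sawSum a (suc k) k
dedekind≡sawSum : ∀ a k → dedekind a (suc k) ≡ sawSum a k (suc k)

dedekind≡sawSum a zero    = refl
dedekind≡sawSum a (suc k) =
  -- Two summands are split off so that the remaining count k does not contain `suc k`, the term
  -- abstracted next.
  cong (saw (+ suc (suc k) / suc (suc k)) ℚ.* saw ((a * + suc (suc k)) / suc (suc k)) ℚ.+_)
    (cong (saw (+ suc k / suc (suc k)) ℚ.* saw ((a * + suc k) / suc (suc k)) ℚ.+_) (go≡sawSum-suc a k))

go≡sawSum-suc a k with suc k
... | K = go≡sawSum a K k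

go≡sawSum a K zero    = refl
go≡sawSum a K (suc j) = cong (saw (+ suc j / suc K) ℚ.* saw ((a * + suc j) / suc K) ℚ.+_) (go≡sawSum a K j)

-- The factor 4m² gives 2m to each sawtooth. The arguments are x + 1 because the Dedekind sum starts
-- at 1 and `sum` at 0.
sawSum-scaled : ∀ a k j → sawSum a k j ℚ.* ι (+ 4 * (+ suc k * + suc k)) ≡
  ι (sum j (λ x → Q (suc k) (1ℤ * (x + 1ℤ)) * Q (suc k) (a * (x + 1ℤ))))
sawSum-scaled a k zero    = ℚ.*-zeroˡ (ι (+ 4 * (+ suc k * + suc k)))
sawSum-scaled a k (suc j) = begin
  (u ℚ.* v ℚ.+ s) ℚ.* ι (+ 4 * (+ m * + m))
    ≡⟨ ℚ.*-distribʳ-+ (ι (+ 4 * (+ m * + m))) (u ℚ.* v) s ⟩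
  u ℚ.* v ℚ.* ι (+ 4 * (+ m * + m)) ℚ.+ s ℚ.* ι (+ 4 * (+ m * + m))
    ≡⟨ cong₂ ℚ._+_ term (sawSum-scaled a k j) ⟩
  ι (h (+ j)) ℚ.+ ι (sum j h)
    ≡⟨ ℚ.+-comm (ι (h (+ j))) (ι (sum j h)) ⟩
  ι (sum j h) ℚ.+ ι (h (+ j))
    ≡⟨ ι-+ (sum j h) (h (+ j)) ⟨
  ι (sum (suc j) h) ∎
  where
  m : ℕ
  m = suc k
  u v s : ℚ
  u = saw (+ suc j / m)
  v = saw ((a * + suc j) / m)
  s = sawSum a k j
  h : ℤ → ℤ
  h x = Q m (1ℤ * (x + 1ℤ)) * Q m (a * (x + 1ℤ))
  four : ∀ m → + 4 * (m * m) ≡ (+ 2 * m) * (+ 2 * m)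
  four = solve-∀
  j+1 : + suc j ≡ + j + 1ℤ
  j+1 = ℤ.+-comm 1ℤ (+ j)
  term : u ℚ.* v ℚ.* ι (+ 4 * (+ m * + m)) ≡ ι (h (+ j))
  term = begin
    u ℚ.* v ℚ.* ι (+ 4 * (+ m * + m))
      ≡⟨ cong (u ℚ.* v ℚ.*_) (trans (cong ι (four (+ m))) (ι-* (+ 2 * + m) (+ 2 * + m))) ⟩
    u ℚ.* v ℚ.* (ι (+ 2 * + m) ℚ.* ι (+ 2 * + m))
      ≡⟨ solve 3 (λ u v w → u :* v :* (w :* w) := u :* w :* (v :* w)) refl u v (ι (+ 2 * + m)) ⟩
    u ℚ.* ι (+ 2 * + m) ℚ.* (v ℚ.* ι (+ 2 * + m))
      ≡⟨ cong₂ ℚ._*_ (saw-/ (+ suc j) m) (saw-/ (a * + suc j) m) ⟩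
    ι (Q m (+ suc j)) ℚ.* ι (Q m (a * + suc j))
      ≡⟨ ι-* (Q m (+ suc j)) (Q m (a * + suc j)) ⟨
    ι (Q m (+ suc j) * Q m (a * + suc j))
      ≡⟨ cong ι (cong₂ (λ x y → Q m x * Q m (a * y)) (trans j+1 (sym (ℤ.*-identityˡ (+ j + 1ℤ)))) j+1) ⟩
    ι (h (+ j)) ∎

-- Split 12 as 3 · 4; periodicity moves the range 1, ..., m to 0, ..., m - 1.
S-scaled : ∀ a m .{{_ : NonZero m}} → S a m ℚ.* ι (+ m * + m) ≡ ι (+ 3 * H m 1ℤ a)
S-scaled a m@(suc k) = begin
  ι (+ 12) ℚ.* dedekind a m ℚ.* ι (+ m * + m)
    ≡⟨ solve 2 (λ d w → con (ι (+ 12)) :* d :* w := con (ι (+ 3)) :* (d :* (con (ι (+ 4)) :* w))) refl (dedekind a m) (ι (+ m * + m)) ⟩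
  ι (+ 3) ℚ.* (dedekind a m ℚ.* (ι (+ 4) ℚ.* ι (+ m * + m)))
    ≡⟨ cong (ι (+ 3) ℚ.*_) (cong₂ ℚ._*_ (dedekind≡sawSum a k) (sym (ι-* (+ 4) (+ m * + m)))) ⟩
  ι (+ 3) ℚ.* (sawSum a k m ℚ.* ι (+ 4 * (+ m * + m)))
    ≡⟨ cong (ι (+ 3) ℚ.*_) (sawSum-scaled a k m) ⟩
  ι (+ 3) ℚ.* ι (sum m (λ x → h (x + 1ℤ)))
    ≡⟨ cong (λ z → ι (+ 3) ℚ.* ι z) (sum-shift m h h-periodic 1ℤ) ⟩
  ι (+ 3) ℚ.* ι (H m 1ℤ a)
    ≡⟨ ι-* (+ 3) (H m 1ℤ a) ⟨
  ι (+ 3 * H m 1ℤ a) ∎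
  where
  h : ℤ → ℤ
  h x = Q m (1ℤ * x) * Q m (a * x)
  h-periodic : Periodic m h
  h-periodic e = cong₂ ℤ._*_ (Q-periodic m (mod-*ˡ 1ℤ e)) (Q-periodic m (mod-*ˡ a e))

+∣a²+1∣ : ∀ a → + ∣ a * a + 1ℤ ∣ ≡ a * a + 1ℤ
+∣a²+1∣ (+ n)    = trans (cong (λ z → + ∣ z + 1ℤ ∣) (sym (ℤ.pos-* n n))) (cong (ℤ._+ 1ℤ) (ℤ.pos-* n n))
+∣a²+1∣ -[1+ n ] = refl

-- Multiplication by N = (tqe)² clears every denominator through `S-scaled`, and N is cancelled at
-- the end.
S-identity : ∀ q t e .{{_ : NonZero q}} .{{_ : NonZero t}} .{{_ : NonZero e}} a tstar →
  ScaledIdentity q t e tstar a →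
  S a (q ℕ.* e) ≡ (((((+ (q ℕ.* q) - 1ℤ) * a) / (t ℕ.* q)) {{ℕ.m*n≢0 t q}} ℚ.- S (a * + q) t) ℚ.+ S (a * tstar) q)
S-identity q t e a tstar identity = ι-cancel N (trans left (sym right))
  where
  instance
    tq≢0 : NonZero (t ℕ.* q)
    tq≢0 = ℕ.m*n≢0 t q
    qe≢0 : NonZero (q ℕ.* e)
    qe≢0 = ℕ.m*n≢0 q e
    tqe≢0 : NonZero (t ℕ.* (q ℕ.* e))
    tqe≢0 = ℕ.m*n≢0 t (q ℕ.* e)

  N : ℕ
  N = t ℕ.* (q ℕ.* e) ℕ.* (t ℕ.* (q ℕ.* e))

  instance
    N≢0 : NonZero N
    N≢0 = ℕ.m*n≢0 (t ℕ.* (q ℕ.* e)) (t ℕ.* (q ℕ.* e))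

  tt qq ee tq n Hb Ht Hq : ℤ
  tt = + t * + t
  qq = + q * + q
  ee = + e * + e
  tq = + t * + q
  n  = (qq - 1ℤ) * a
  Hb = + 3 * H (q ℕ.* e) 1ℤ a
  Ht = + 3 * H t 1ℤ (a * + q)
  Hq = + 3 * H q 1ℤ (a * tstar)

  +N : + N ≡ + t * + (q ℕ.* e) * (+ t * + (q ℕ.* e))
  +N = trans (ℤ.pos-* (t ℕ.* (q ℕ.* e)) (t ℕ.* (q ℕ.* e))) (cong (λ z → z * z) (ℤ.pos-* t (q ℕ.* e)))

  left : S a (q ℕ.* e) ℚ.* ι (+ N) ≡ ι (Hb * tt)
  left = begin
    S a (q ℕ.* e) ℚ.* ι (+ N)                                   ≡⟨ cong (λ z → S a (q ℕ.* e) ℚ.* ι z) (trans +N (ring (+ t) (+ (q ℕ.* e)))) ⟩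
    S a (q ℕ.* e) ℚ.* ι (bb * tt)                             ≡⟨ cong (S a (q ℕ.* e) ℚ.*_) (ι-* bb tt) ⟩
    S a (q ℕ.* e) ℚ.* (ι bb ℚ.* ι tt)                           ≡⟨ ℚ.*-assoc (S a (q ℕ.* e)) (ι bb) (ι tt) ⟨
    S a (q ℕ.* e) ℚ.* ι bb ℚ.* ι tt                             ≡⟨ cong (ℚ._* ι tt) (S-scaled a (q ℕ.* e)) ⟩
    ι Hb ℚ.* ι tt                                               ≡⟨ ι-* Hb tt ⟨
    ι (Hb * tt)                                               ∎
    where
    bb : ℤ
    bb = + (q ℕ.* e) * + (q ℕ.* e)
    ring : ∀ t b → t * b * (t * b) ≡ b * b * (t * t)
    ring = solve-∀

  α β γ : ℚ
  α = ((+ (q ℕ.* q) - 1ℤ) * a) / (t ℕ.* q)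
  β = S (a * + q) t
  γ = S (a * tstar) q

  α-scaled : α ℚ.* ι tq ≡ ι n
  α-scaled = trans (cong (λ z → α ℚ.* ι z) (sym (ℤ.pos-* t q))) (trans
    (/-*-denominator ((+ (q ℕ.* q) - 1ℤ) * a) (t ℕ.* q))
    (cong (λ z → ι ((z - 1ℤ) * a)) (ℤ.pos-* q q)))

  ιN : ι (+ N) ≡ ι tt ℚ.* ι qq ℚ.* ι ee
  ιN = begin
    ι (+ N)                       ≡⟨ cong ι (trans +N (trans (cong (λ z → + t * z * (+ t * z)) (ℤ.pos-* q e)) (ring (+ t) (+ q) (+ e)))) ⟩
    ι (tt * qq * ee)          ≡⟨ ι-* (tt * qq) ee ⟩
    ι (tt * qq) ℚ.* ι ee        ≡⟨ cong (ℚ._* ι ee) (ι-* tt qq) ⟩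
    ι tt ℚ.* ι qq ℚ.* ι ee        ∎
    where
    ring : ∀ t q e → t * (q * e) * (t * (q * e)) ≡ t * t * (q * q) * (e * e)
    ring = solve-∀

  ιttqq : ι tt ℚ.* ι qq ≡ ι tq ℚ.* ι tq
  ιttqq = trans (sym (ι-* tt qq)) (trans (cong ι (ring (+ t) (+ q))) (ι-* tq tq))
    where
    ring : ∀ t q → t * t * (q * q) ≡ t * q * (t * q)
    ring = solve-∀

  right : ((α ℚ.- β) ℚ.+ γ) ℚ.* ι (+ N) ≡ ι (Hb * tt)
  right = begin
    ((α ℚ.- β) ℚ.+ γ) ℚ.* ι (+ N)
      ≡⟨ cong (((α ℚ.- β) ℚ.+ γ) ℚ.*_) ιN ⟩
    ((α ℚ.- β) ℚ.+ γ) ℚ.* (ι tt ℚ.* ι qq ℚ.* ι ee)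
      ≡⟨ solve 6 (λ α β γ x y z → ((α :- β) :+ γ) :* (x :* y :* z) := ((α :* (x :* y) :- β :* x :* y) :+ γ :* y :* x) :* z) refl α β γ (ι tt) (ι qq) (ι ee) ⟩
    ((α ℚ.* (ι tt ℚ.* ι qq) ℚ.- β ℚ.* ι tt ℚ.* ι qq) ℚ.+ γ ℚ.* ι qq ℚ.* ι tt) ℚ.* ι ee
      ≡⟨ cong₂ (λ x y → ((x ℚ.- y) ℚ.+ γ ℚ.* ι qq ℚ.* ι tt) ℚ.* ι ee)
           (trans (cong (α ℚ.*_) ιttqq) (trans (sym (ℚ.*-assoc α (ι tq) (ι tq))) (cong (ℚ._* ι tq) α-scaled)))
           (cong (ℚ._* ι qq) (S-scaled (a * + q) t)) ⟩
    ((ι n ℚ.* ι tq ℚ.- ι Ht ℚ.* ι qq) ℚ.+ γ ℚ.* ι qq ℚ.* ι tt) ℚ.* ι ee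
      ≡⟨ cong (λ z → ((ι n ℚ.* ι tq ℚ.- ι Ht ℚ.* ι qq) ℚ.+ z ℚ.* ι tt) ℚ.* ι ee) (S-scaled (a * tstar) q) ⟩
    ((ι n ℚ.* ι tq ℚ.- ι Ht ℚ.* ι qq) ℚ.+ ι Hq ℚ.* ι tt) ℚ.* ι ee
      ≡⟨ cong (ℚ._* ι ee) (cong₂ ℚ._+_ (cong₂ ℚ._-_ (ι-* n tq) (ι-* Ht qq)) (ι-* Hq tt)) ⟨
    ((ι (n * tq) ℚ.- ι (Ht * qq)) ℚ.+ ι (Hq * tt)) ℚ.* ι ee
      ≡⟨ cong (λ z → (z ℚ.+ ι (Hq * tt)) ℚ.* ι ee) (ι-- (n * tq) (Ht * qq)) ⟨
    (ι (n * tq - Ht * qq) ℚ.+ ι (Hq * tt)) ℚ.* ι ee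
      ≡⟨ cong (ℚ._* ι ee) (ι-+ (n * tq - Ht * qq) (Hq * tt)) ⟨
    ι (n * tq - Ht * qq + Hq * tt) ℚ.* ι ee
      ≡⟨ ι-* (n * tq - Ht * qq + Hq * tt) ee ⟨
    ι ((n * tq - Ht * qq + Hq * tt) * ee)
      ≡⟨ cong ι identity ⟨
    ι (Hb * tt) ∎

theorem4 : (q t : ℕ) .{{_ : NonZero q}} .{{_ : NonZero t}} (a : ℤ) →
    gcd (+ t) (+ q) ≡ + 1 → gcd a (+ q) ≡ + 1 → + t ∣ (a ℤ.* a ℤ.+ + 1) →
    (tstar : ℤ) → + q ∣ (+ t ℤ.* tstar ℤ.- + 1) →
    S a ((q ℕ.* ∣ a ℤ.* a ℤ.+ + 1 ∣) ℕ./ t)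
    ≡ ((((+ (q ℕ.* q) ℤ.- + 1) ℤ.* a) / (t ℕ.* q)) {{m*n≢0 t q}} ℚ.- S (a ℤ.* + q) t) ℚ.+ S (a ℤ.* tstar) q
-- The signed form of divisibility yields the quotient k that the congruence t t* ≡ 1 requires.
theorem4 q t a _ a⊥q (ℕ.divides e ∣a²+1∣≡et) tstar q∣tt*-1 with Signed.∣ᵤ⇒∣ {i = + t * tstar - 1ℤ} q∣tt*-1
... | Signed.divides k tt*-1≡kq =
  trans (cong (S a) b≡qe)
    (S-identity q t e a tstar (Identity.scaled-identity q t e tstar tt*≡1 a (coprime⇒unit {∣ a ∣} (ℤ.+-injective a⊥q)) et≡a²+1))
  where
  et≡a²+1 : + e * + t ≡ a * a + 1ℤ
  et≡a²+1 = trans (sym (ℤ.pos-* e t)) (trans (cong +_ (sym ∣a²+1∣≡et)) (+∣a²+1∣ a))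

  instance
    e≢0 : NonZero e
    e≢0 = ℕ.≢-nonZero λ e≡0 → a²+1≢0 a (trans (sym et≡a²+1) (cong (λ e → + e * + t) e≡0))
      where
      a²+1≢0 : ∀ a → ¬ a * a + 1ℤ ≡ 0ℤ
      a²+1≢0 (+ n)    eq with () ← trans (ℕ.+-comm 1 (n ℕ.* n)) (ℤ.+-injective (trans (cong (ℤ._+ 1ℤ) (ℤ.pos-* n n)) eq))
      a²+1≢0 -[1+ n ] ()

  -- The division is exact, since q (a² + 1) = q e t.
  b≡qe : (q ℕ.* ∣ a * a + + 1 ∣) ℕ./ t ≡ q ℕ.* e
  b≡qe = trans (cong (λ m → (q ℕ.* m) ℕ./ t) ∣a²+1∣≡et)
    (trans (cong (ℕ._/ t) (sym (ℕ.*-assoc q e t))) (ℕ.m*n/n≡m (q ℕ.* e) t))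

  ring : ∀ x → x ≡ 1ℤ + (x - 1ℤ)
  ring = solve-∀

  tt*≡1 : + t * tstar ≡ 1ℤ mod q
  tt*≡1 = k , trans (ring (+ t * tstar)) (cong (λ z → 1ℤ + z) tt*-1≡kq)
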